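{- Let $\lambda$ be a nonzero real number and $n$ a positive integer. Then, for real $x$, $$(1+x)F_{n,\lambda}(x)=\sum_{k=1}^{n+1}S_{2,\lambda}(n+1,k)(k-1)!\,x^{k}+n\lambda\sum_{k=1}^{n}S_{2,\lambda}(n,k)(k-1)!\,x^{k}.$$ Moreover, $$\int_{0}^{x}\frac{F_{n+1,\lambda}(t)}{t}\,dt+n\lambda\int_{0}^{x}\frac{F_{n,\lambda}(t)}{t}\,dt=(1+x)F_{n,\lambda}(x).$$
   Context: For real $y$ and integer $k\ge0$: $(y)_{0,\lambda}=1$, $(y)_{k,\lambda}=y(y-\lambda)\cdots(y-(k-1)\lambda)$; $(y)_0=1$, $(y)_k=y(y-1)\cdots(y-k+1)$. The degenerate exponential is $e_\lambda(t)=\sum_{k\ge0}(1)_{k,\lambda}t^k/k!=(1+\lambda t)^{1/\lambda}$. The degenerate Stirling numbers of the second kind are defined by $(x)_{n,\lambda}=\sum_{k=0}^{n}S_{2,\lambda}(n,k)(x)_{k}$ ($n\ge0$). The degenerate Fubini polynomials are defined by $\frac{1}{1-x(e_\lambda(t)-1)}=\sum_{n\ge0}F_{n,\lambda}(x)\frac{t^n}{n!}$; equivalently $F_{n,\lambda}(x)=\sum_{k=0}^{n}S_{2,\lambda}(n,k)k!\,x^k$. -}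

module Defs where

open import Algebra.Bundles using (CommutativeRing; Semiring)
import Algebra.Definitions.RawSemiring as RawSemiringDefinitions
open import Data.Fin.Base using (Fin; toℕ; fromℕ; inject₁)
  renaming (zero to fzero; suc to fsuc)
open import Data.Integer.Base using (+_)
open import Data.Nat.Base as ℕ using (ℕ; zero; suc; _!)
import Data.Nat.Properties as ℕ
open import Data.Product.Base using (∃; _×_; _,_; proj₁; proj₂)
open import Data.Rational.Base as ℚ using (ℚ; 0ℚ; 1ℚ; ½)
import Data.Rational.Properties as ℚ
open import Data.Rational.Solver using (module +-*-Solver)
open import Data.Sum.Base using (_⊎_; inj₁; inj₂)
open import Level using (0ℓ)
open import Relation.Binary.PropositionalEquality
  using (_≡_; refl; sym; trans; cong; cong₂; subst)
open import Relation.Nullary using (¬_; yes; no; contradiction)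

abstract
  ∣p-q∣≡∣q-p∣ : ∀ p q → ℚ.∣ p ℚ.- q ∣ ≡ ℚ.∣ q ℚ.- p ∣
  ∣p-q∣≡∣q-p∣ p q = trans (sym (ℚ.∣-p∣≡∣p∣ (p ℚ.- q)))
    (cong ℚ.∣_∣ (solve 2 (λ a b → :- (a :- b) := b :- a) refl p q))
    where open +-*-Solver

  ½+½ : ∀ ε → ε ℚ.* ½ ℚ.+ ε ℚ.* ½ ≡ ε
  ½+½ ε = trans (sym (ℚ.*-distribˡ-+ ε ½ ½)) (ℚ.*-identityʳ ε)

  0<* : ∀ {p q} → 0ℚ ℚ.< p → 0ℚ ℚ.< q → 0ℚ ℚ.< p ℚ.* q
  0<* {p} {q} 0<p 0<q = subst (ℚ._< p ℚ.* q) (ℚ.*-zeroʳ p)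
    (ℚ.*-monoʳ-<-pos p {{ℚ.positive 0<p}} 0<q)

  0<ε½ : ∀ ε → 0ℚ ℚ.< ε → 0ℚ ℚ.< ε ℚ.* ½
  0<ε½ ε 0<ε = 0<* {ε} {½} 0<ε (ℚ.positive⁻¹ ½)

  *-mono : ∀ {p q r s} → 0ℚ ℚ.≤ q → 0ℚ ℚ.≤ r →
           p ℚ.≤ q → r ℚ.≤ s → p ℚ.* r ℚ.≤ q ℚ.* s
  *-mono {p} {q} {r} 0≤q 0≤r p≤q r≤s = ℚ.≤-trans
    (ℚ.*-monoʳ-≤-nonNeg r {{ℚ.nonNegative 0≤r}} p≤q)
    (ℚ.*-monoˡ-≤-nonNeg q {{ℚ.nonNegative 0≤q}} r≤s)

  triangle : ∀ p q r → ℚ.∣ p ℚ.- r ∣ ℚ.≤ ℚ.∣ p ℚ.- q ∣ ℚ.+ ℚ.∣ q ℚ.- r ∣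
  triangle p q r = subst (ℚ._≤ ℚ.∣ p ℚ.- q ∣ ℚ.+ ℚ.∣ q ℚ.- r ∣)
    (cong ℚ.∣_∣ (solve 3 (λ a b c → (a :- b) :+ (b :- c) := a :- c) refl p q r))
    (ℚ.∣p+q∣≤∣p∣+∣q∣ (p ℚ.- q) (q ℚ.- r))
    where open +-*-Solver

  triangle-< : ∀ {ε} p q r → ℚ.∣ p ℚ.- q ∣ ℚ.< ε ℚ.* ½ →
               ℚ.∣ q ℚ.- r ∣ ℚ.< ε ℚ.* ½ → ℚ.∣ p ℚ.- r ∣ ℚ.< ε
  triangle-< {ε} p q r pq qr = ℚ.≤-<-trans (triangle p q r)
    (subst (ℚ.∣ p ℚ.- q ∣ ℚ.+ ℚ.∣ q ℚ.- r ∣ ℚ.<_) (½+½ ε) (ℚ.+-mono-< pq qr))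

  +-close : ∀ {ε} p q r s → ℚ.∣ p ℚ.- q ∣ ℚ.< ε ℚ.* ½ →
            ℚ.∣ r ℚ.- s ∣ ℚ.< ε ℚ.* ½ →
            ℚ.∣ (p ℚ.+ r) ℚ.- (q ℚ.+ s) ∣ ℚ.< ε
  +-close {ε} p q r s pq rs = subst (λ z → ℚ.∣ z ∣ ℚ.< ε)
    (solve 4 (λ a b c d → (a :- b) :+ (c :- d) := (a :+ c) :- (b :+ d)) refl p q r s)
    (ℚ.≤-<-trans (ℚ.∣p+q∣≤∣p∣+∣q∣ (p ℚ.- q) (r ℚ.- s))
      (subst (ℚ.∣ p ℚ.- q ∣ ℚ.+ ℚ.∣ r ℚ.- s ∣ ℚ.<_) (½+½ ε) (ℚ.+-mono-< pq rs)))
    where open +-*-Solver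

  neg-close : ∀ p q → ℚ.∣ (ℚ.- p) ℚ.- (ℚ.- q) ∣ ≡ ℚ.∣ p ℚ.- q ∣
  neg-close p q = trans
    (cong ℚ.∣_∣ (solve 2 (λ a b → (:- a) :- (:- b) := b :- a) refl p q))
    (∣p-q∣≡∣q-p∣ q p)
    where open +-*-Solver

  ∣p∣≤∣q∣+∣p-q∣ : ∀ p q → ℚ.∣ p ∣ ℚ.≤ ℚ.∣ q ∣ ℚ.+ ℚ.∣ p ℚ.- q ∣
  ∣p∣≤∣q∣+∣p-q∣ p q = subst (λ z → ℚ.∣ z ∣ ℚ.≤ ℚ.∣ q ∣ ℚ.+ ℚ.∣ p ℚ.- q ∣)
    (solve 2 (λ a b → b :+ (a :- b) := a) refl p q)
    (ℚ.∣p+q∣≤∣p∣+∣q∣ q (p ℚ.- q))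
    where open +-*-Solver

  ∣∣-sub : ∀ p q → ℚ.∣ p ∣ ℚ.- ℚ.∣ q ∣ ℚ.≤ ℚ.∣ p ℚ.- q ∣
  ∣∣-sub p q = subst (ℚ.∣ p ∣ ℚ.- ℚ.∣ q ∣ ℚ.≤_)
    (solve 2 (λ a b → (a :+ b) :- a := b) refl ℚ.∣ q ∣ ℚ.∣ p ℚ.- q ∣)
    (ℚ.+-monoˡ-≤ (ℚ.- ℚ.∣ q ∣) (∣p∣≤∣q∣+∣p-q∣ p q))
    where open +-*-Solver

  abs-close : ∀ p q → ℚ.∣ ℚ.∣ p ∣ ℚ.- ℚ.∣ q ∣ ∣ ℚ.≤ ℚ.∣ p ℚ.- q ∣
  abs-close p q with ℚ.∣p∣≡p∨∣p∣≡-p (ℚ.∣ p ∣ ℚ.- ℚ.∣ q ∣)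
  ... | inj₁ e = subst (ℚ._≤ ℚ.∣ p ℚ.- q ∣) (sym e) (∣∣-sub p q)
  ... | inj₂ e = subst (ℚ._≤ ℚ.∣ p ℚ.- q ∣)
    (sym (trans e (solve 2 (λ a b → :- (a :- b) := b :- a) refl ℚ.∣ p ∣ ℚ.∣ q ∣)))
    (subst (ℚ.∣ q ∣ ℚ.- ℚ.∣ p ∣ ℚ.≤_) (∣p-q∣≡∣q-p∣ q p) (∣∣-sub q p))
    where open +-*-Solver

  1/-cancel : ∀ ε {M} (0<M : 0ℚ ℚ.< M) →
              ∃ λ δ → (0ℚ ℚ.< ε → 0ℚ ℚ.< δ) × M ℚ.* δ ≡ ε
  1/-cancel ε {M} 0<M = ε ℚ.* K , (λ 0<ε → 0<* {ε} {K} 0<ε 0<K) , trans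
    (solve 3 (λ a b c → a :* (b :* c) := b :* (a :* c)) refl M ε K)
    (trans (cong (ε ℚ.*_) (ℚ.*-inverseʳ M)) (ℚ.*-identityʳ ε))
    where
    open +-*-Solver
    instance
      M-pos : ℚ.Positive M
      M-pos = ℚ.positive 0<M
      M≢0 : ℚ.NonZero M
      M≢0 = ℚ.pos⇒nonZero M
    K : ℚ
    K = ℚ.1/ M
    0<K : 0ℚ ℚ.< K
    0<K = ℚ.positive⁻¹ K {{ℚ.1/pos⇒pos M}}

  *-close : ∀ ε {M} → 0ℚ ℚ.< M → 0ℚ ℚ.< ε →
            ∃ λ δ → 0ℚ ℚ.< δ × (∀ p q r s → ℚ.∣ p ∣ ℚ.≤ M → ℚ.∣ s ∣ ℚ.≤ M →
              ℚ.∣ p ℚ.- q ∣ ℚ.< δ → ℚ.∣ r ℚ.- s ∣ ℚ.< δ →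
              ℚ.∣ (p ℚ.* r) ℚ.- (q ℚ.* s) ∣ ℚ.< ε)
  *-close ε {M} 0<M 0<ε = δ , 0<δ , close
    where
    open +-*-Solver
    cancel : ∃ λ δ → (0ℚ ℚ.< ε ℚ.* ½ → 0ℚ ℚ.< δ) × M ℚ.* δ ≡ ε ℚ.* ½
    cancel = 1/-cancel (ε ℚ.* ½) {M} 0<M
    δ : ℚ
    δ = proj₁ cancel
    0<δ : 0ℚ ℚ.< δ
    0<δ = proj₁ (proj₂ cancel) (0<ε½ ε 0<ε)
    Mδ≡ε½ : M ℚ.* δ ≡ ε ℚ.* ½
    Mδ≡ε½ = proj₂ (proj₂ cancel)
    bound : ∀ a b → ℚ.∣ a ∣ ℚ.≤ M → ℚ.∣ b ∣ ℚ.< δ → ℚ.∣ a ℚ.* b ∣ ℚ.< ε ℚ.* ½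
    bound a b a≤M b<δ = subst (ℚ._< ε ℚ.* ½) (sym (ℚ.∣p*q∣≡∣p∣*∣q∣ a b))
      (ℚ.≤-<-trans
        (ℚ.*-monoʳ-≤-nonNeg ℚ.∣ b ∣ {{ℚ.nonNegative (ℚ.0≤∣p∣ b)}} a≤M)
        (subst (M ℚ.* ℚ.∣ b ∣ ℚ.<_) Mδ≡ε½
          (ℚ.*-monoʳ-<-pos M {{ℚ.positive 0<M}} b<δ)))
    split : ∀ p q r s →
            p ℚ.* (r ℚ.- s) ℚ.+ s ℚ.* (p ℚ.- q) ≡ (p ℚ.* r) ℚ.- (q ℚ.* s)
    split = solve 4 (λ a b c d → a :* (c :- d) :+ d :* (a :- b) := a :* c :- b :* d) refl
    close : ∀ p q r s → ℚ.∣ p ∣ ℚ.≤ M → ℚ.∣ s ∣ ℚ.≤ M →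
            ℚ.∣ p ℚ.- q ∣ ℚ.< δ → ℚ.∣ r ℚ.- s ∣ ℚ.< δ →
            ℚ.∣ (p ℚ.* r) ℚ.- (q ℚ.* s) ∣ ℚ.< ε
    close p q r s p≤M s≤M pq rs = subst (λ z → ℚ.∣ z ∣ ℚ.< ε) (split p q r s)
      (ℚ.≤-<-trans (ℚ.∣p+q∣≤∣p∣+∣q∣ (p ℚ.* (r ℚ.- s)) (s ℚ.* (p ℚ.- q)))
        (subst (ℚ.∣ p ℚ.* (r ℚ.- s) ∣ ℚ.+ ℚ.∣ s ℚ.* (p ℚ.- q) ∣ ℚ.<_) (½+½ ε)
          (ℚ.+-mono-< (bound p (r ℚ.- s) p≤M rs) (bound s (p ℚ.- q) s≤M pq))))

-- Total reciprocal on ℚ with 1/0 = 0; used only to define real inverses.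
recip : ℚ → ℚ
recip q with q ℚ.≟ 0ℚ
... | yes _  = 0ℚ
... | no q≢0 = ℚ.1/_ q {{ℚ.≢-nonZero q≢0}}

abstract
  recip-inverse : ∀ q → ¬ q ≡ 0ℚ → q ℚ.* recip q ≡ 1ℚ
  recip-inverse q q≢0 with q ℚ.≟ 0ℚ
  ... | yes q≡0  = contradiction q≡0 q≢0
  ... | no  q≢0′ = ℚ.*-inverseʳ q {{ℚ.≢-nonZero q≢0′}}

  0<∣p∣⇒p≢0 : ∀ p {c} → 0ℚ ℚ.< c → c ℚ.≤ ℚ.∣ p ∣ → ¬ p ≡ 0ℚ
  0<∣p∣⇒p≢0 .0ℚ 0<c c≤ refl = ℚ.<-irrefl refl (ℚ.<-≤-trans 0<c c≤)

  recip-close : ∀ ε {c} → 0ℚ ℚ.< c → 0ℚ ℚ.< ε →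
                ∃ λ δ → 0ℚ ℚ.< δ × (∀ p q → c ℚ.≤ ℚ.∣ p ∣ → c ℚ.≤ ℚ.∣ q ∣ →
                  ℚ.∣ p ℚ.- q ∣ ℚ.< δ → ℚ.∣ recip p ℚ.- recip q ∣ ℚ.< ε)
  recip-close ε {c} 0<c 0<ε = δ , 0<δ , λ p q c≤p c≤q pq →
    ℚ.*-cancelˡ-<-nonNeg (c ℚ.* c) {{ℚ.nonNegative (ℚ.<⇒≤ 0<cc)}}
      (ℚ.≤-<-trans (ℚ.≤-trans
        (ℚ.*-monoʳ-≤-nonNeg ℚ.∣ recip p ℚ.- recip q ∣
          {{ℚ.nonNegative (ℚ.0≤∣p∣ (recip p ℚ.- recip q))}}
          (*-mono {c} {ℚ.∣ p ∣} {c} {ℚ.∣ q ∣} (ℚ.0≤∣p∣ p) (ℚ.<⇒≤ 0<c) c≤p c≤q))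
        (ℚ.≤-reflexive (identity p q (0<∣p∣⇒p≢0 p 0<c c≤p) (0<∣p∣⇒p≢0 q 0<c c≤q))))
        pq)
    where
    0<cc : 0ℚ ℚ.< c ℚ.* c
    0<cc = 0<* {c} {c} 0<c 0<c
    δ : ℚ
    δ = c ℚ.* c ℚ.* ε
    0<δ : 0ℚ ℚ.< δ
    0<δ = 0<* {c ℚ.* c} {ε} 0<cc 0<ε
    identity : ∀ p q → ¬ p ≡ 0ℚ → ¬ q ≡ 0ℚ →
               ℚ.∣ p ∣ ℚ.* ℚ.∣ q ∣ ℚ.* ℚ.∣ recip p ℚ.- recip q ∣ ≡ ℚ.∣ p ℚ.- q ∣
    identity p q p≢0 q≢0 = trans
      (trans (cong (ℚ._* ℚ.∣ recip p ℚ.- recip q ∣) (sym (ℚ.∣p*q∣≡∣p∣*∣q∣ p q)))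
             (sym (ℚ.∣p*q∣≡∣p∣*∣q∣ (p ℚ.* q) (recip p ℚ.- recip q))))
      (trans (cong ℚ.∣_∣ (trans
        (solve 4 (λ a b a′ b′ → a :* b :* (a′ :- b′) := b :* (a :* a′) :- a :* (b :* b′))
          refl p q (recip p) (recip q))
        (cong₂ ℚ._-_
          (trans (cong (q ℚ.*_) (recip-inverse p p≢0)) (ℚ.*-identityʳ q))
          (trans (cong (p ℚ.*_) (recip-inverse q q≢0)) (ℚ.*-identityʳ p)))))
        (∣p-q∣≡∣q-p∣ q p))
      where open +-*-Solver

Eventually : (ℕ → Set) → Set
Eventually P = ∃ λ N → ∀ n → N ℕ.≤ n → P n

Cauchy : (ℕ → ℚ) → Set
Cauchy s = ∀ ε → 0ℚ ℚ.< ε →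
  ∃ λ N → ∀ m n → N ℕ.≤ m → N ℕ.≤ n → ℚ.∣ s m ℚ.- s n ∣ ℚ.< ε

-- Real equality is the setoid relation _≈_ below, not _≡_.
record ℝ : Set where
  constructor mkℝ
  field
    seq    : ℕ → ℚ
    cauchy : Cauchy seq

open ℝ public

infix 4 _≈_ _<_ _≤_ _#_

_≈_ : ℝ → ℝ → Set
x ≈ y = ∀ ε → 0ℚ ℚ.< ε → Eventually λ n → ℚ.∣ seq x n ℚ.- seq y n ∣ ℚ.< ε

_<_ : ℝ → ℝ → Set
x < y = ∃ λ ε → 0ℚ ℚ.< ε × Eventually λ n → seq x n ℚ.+ ε ℚ.≤ seq y n

_≤_ : ℝ → ℝ → Set
x ≤ y = ∀ ε → 0ℚ ℚ.< ε → Eventually λ n → seq x n ℚ.≤ seq y n ℚ.+ ε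

_#_ : ℝ → ℝ → Set
x # y = x < y ⊎ y < x

abstract
  both : ∀ {P Q R : ℕ → Set} → (∀ n → P n → Q n → R n) →
         Eventually P → Eventually Q → Eventually R
  both f (M , p) (N , q) = M ℕ.⊔ N , λ n le →
    f n (p n (ℕ.≤-trans (ℕ.m≤m⊔n M N) le)) (q n (ℕ.≤-trans (ℕ.m≤n⊔m M N) le))

  bounded : ∀ x → ∃ λ M → 0ℚ ℚ.< M × Eventually λ n → ℚ.∣ seq x n ∣ ℚ.≤ M
  bounded x = let N , close = cauchy x 1ℚ (ℚ.positive⁻¹ 1ℚ) in
    ℚ.∣ seq x N ∣ ℚ.+ 1ℚ ,
    ℚ.+-mono-≤-< (ℚ.0≤∣p∣ (seq x N)) (ℚ.positive⁻¹ 1ℚ) ,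
    N , λ n le → ℚ.≤-trans (∣p∣≤∣q∣+∣p-q∣ (seq x n) (seq x N))
      (ℚ.+-monoʳ-≤ ℚ.∣ seq x N ∣ (ℚ.<⇒≤ (close n N le ℕ.≤-refl)))

  bounded₂ : ∀ x y → ∃ λ M → 0ℚ ℚ.< M ×
             Eventually λ n → ℚ.∣ seq x n ∣ ℚ.≤ M × ℚ.∣ seq y n ∣ ℚ.≤ M
  bounded₂ x y = let A , 0<A , a = bounded x ; B , 0<B , b = bounded y in
    A ℚ.+ B , ℚ.+-mono-< 0<A 0<B ,
    both (λ n p q →
      subst (ℚ._≤ A ℚ.+ B) (ℚ.+-identityʳ _) (ℚ.+-mono-≤ p (ℚ.<⇒≤ 0<B)) ,
      subst (ℚ._≤ A ℚ.+ B) (ℚ.+-identityˡ _) (ℚ.+-mono-≤ (ℚ.<⇒≤ 0<A) q)) a b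

  ∣p-p∣≡0 : ∀ p → ℚ.∣ p ℚ.- p ∣ ≡ 0ℚ
  ∣p-p∣≡0 p = cong ℚ.∣_∣ (ℚ.+-inverseʳ p)

  const-cauchy : ∀ q → Cauchy (λ _ → q)
  const-cauchy q ε 0<ε = 0 , λ _ _ _ _ → subst (ℚ._< ε) (sym (∣p-p∣≡0 q)) 0<ε

  +-cauchy : ∀ x y → Cauchy (λ n → seq x n ℚ.+ seq y n)
  +-cauchy x y ε 0<ε =
    let M , p = cauchy x (ε ℚ.* ½) (0<ε½ ε 0<ε)
        N , q = cauchy y (ε ℚ.* ½) (0<ε½ ε 0<ε) in
    M ℕ.⊔ N , λ m n lm ln →
    +-close {ε} (seq x m) (seq x n) (seq y m) (seq y n)
      (p m n (ℕ.≤-trans (ℕ.m≤m⊔n M N) lm) (ℕ.≤-trans (ℕ.m≤m⊔n M N) ln))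
      (q m n (ℕ.≤-trans (ℕ.m≤n⊔m M N) lm) (ℕ.≤-trans (ℕ.m≤n⊔m M N) ln))

  neg-cauchy : ∀ x → Cauchy (λ n → ℚ.- seq x n)
  neg-cauchy x ε 0<ε = let N , p = cauchy x ε 0<ε in
    N , λ m n lm ln →
    subst (ℚ._< ε) (sym (neg-close (seq x m) (seq x n))) (p m n lm ln)

  abs-cauchy : ∀ x → Cauchy (λ n → ℚ.∣ seq x n ∣)
  abs-cauchy x ε 0<ε = let N , p = cauchy x ε 0<ε in
    N , λ m n lm ln →
    ℚ.≤-<-trans (abs-close (seq x m) (seq x n)) (p m n lm ln)

  *-cauchy : ∀ x y → Cauchy (λ n → seq x n ℚ.* seq y n)
  *-cauchy x y ε 0<ε =
    let M , 0<M , K , bd = bounded₂ x y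
        δ , 0<δ , close  = *-close ε {M} 0<M 0<ε
        A , p            = cauchy x δ 0<δ
        B , q            = cauchy y δ 0<δ
        K≤ = ℕ.m≤m⊔n K (A ℕ.⊔ B)
        A≤ = ℕ.≤-trans (ℕ.m≤m⊔n A B) (ℕ.m≤n⊔m K (A ℕ.⊔ B))
        B≤ = ℕ.≤-trans (ℕ.m≤n⊔m A B) (ℕ.m≤n⊔m K (A ℕ.⊔ B)) in
    K ℕ.⊔ (A ℕ.⊔ B) , λ m n lm ln →
      close (seq x m) (seq x n) (seq y m) (seq y n)
        (proj₁ (bd m (ℕ.≤-trans K≤ lm))) (proj₂ (bd n (ℕ.≤-trans K≤ ln)))
        (p m n (ℕ.≤-trans A≤ lm) (ℕ.≤-trans A≤ ln))
        (q m n (ℕ.≤-trans B≤ lm) (ℕ.≤-trans B≤ ln))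

fromℚ : ℚ → ℝ
fromℚ q = mkℝ (λ _ → q) (const-cauchy q)

fromNat : ℕ → ℝ
fromNat n = fromℚ (+ n ℚ./ 1)

0ℝ 1ℝ : ℝ
0ℝ = fromℚ 0ℚ
1ℝ = fromℚ 1ℚ

infixl 6 _+_ _-_
infixl 7 _*_
infix  8 -_

_+_ : ℝ → ℝ → ℝ
x + y = mkℝ (λ n → seq x n ℚ.+ seq y n) (+-cauchy x y)

_*_ : ℝ → ℝ → ℝ
x * y = mkℝ (λ n → seq x n ℚ.* seq y n) (*-cauchy x y)

-_ : ℝ → ℝ
- x = mkℝ (λ n → ℚ.- seq x n) (neg-cauchy x)

_-_ : ℝ → ℝ → ℝ
x - y = x + - y

∣_∣ : ℝ → ℝ
∣ x ∣ = mkℝ (λ n → ℚ.∣ seq x n ∣) (abs-cauchy x)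

abstract
  p+c≤0⇒c≤∣p∣ : ∀ p c → p ℚ.+ c ℚ.≤ 0ℚ → c ℚ.≤ ℚ.∣ p ∣
  p+c≤0⇒c≤∣p∣ p c le = ℚ.≤-trans
    (subst (c ℚ.≤_) (ℚ.+-identityʳ (ℚ.- p))
      (subst (ℚ._≤ ℚ.- p ℚ.+ 0ℚ)
        (solve 2 (λ a b → :- a :+ (a :+ b) := b) refl p c)
        (ℚ.+-monoʳ-≤ (ℚ.- p) le)))
    (subst (ℚ.- p ℚ.≤_) (ℚ.∣-p∣≡∣p∣ p) (p≤∣p∣ (ℚ.- p)))
    where
    open +-*-Solver
    p≤∣p∣ : ∀ r → r ℚ.≤ ℚ.∣ r ∣
    p≤∣p∣ r with ℚ.≤-total 0ℚ r
    ... | inj₁ 0≤r = ℚ.≤-reflexive (sym (ℚ.0≤p⇒∣p∣≡p 0≤r))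
    ... | inj₂ r≤0 = ℚ.≤-trans r≤0 (ℚ.0≤∣p∣ r)

  awayFrom0 : ∀ x → x # 0ℝ → ∃ λ c → 0ℚ ℚ.< c × Eventually λ n → c ℚ.≤ ℚ.∣ seq x n ∣
  awayFrom0 x (inj₁ (c , 0<c , N , p)) =
    c , 0<c , N , λ n le → p+c≤0⇒c≤∣p∣ (seq x n) c (p n le)
  awayFrom0 x (inj₂ (c , 0<c , N , p)) = c , 0<c , N , λ n le →
    let c≤x = subst (ℚ._≤ seq x n) (ℚ.+-identityˡ c) (p n le) in
    subst (c ℚ.≤_) (sym (ℚ.0≤p⇒∣p∣≡p (ℚ.≤-trans (ℚ.<⇒≤ 0<c) c≤x))) c≤x

  inverse-cauchy : ∀ x → x # 0ℝ → Cauchy (λ n → recip (seq x n))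
  inverse-cauchy x x#0 ε 0<ε =
    let c , 0<c , K , away = awayFrom0 x x#0
        δ , 0<δ , close    = recip-close ε {c} 0<c 0<ε
        N , p              = cauchy x δ 0<δ in
    K ℕ.⊔ N , λ m n lm ln →
    close (seq x m) (seq x n)
      (away m (ℕ.≤-trans (ℕ.m≤m⊔n K N) lm)) (away n (ℕ.≤-trans (ℕ.m≤m⊔n K N) ln))
      (p m n (ℕ.≤-trans (ℕ.m≤n⊔m K N) lm) (ℕ.≤-trans (ℕ.m≤n⊔m K N) ln))

inverse : (x : ℝ) → x # 0ℝ → ℝ
inverse x x#0 = mkℝ (λ n → recip (seq x n)) (inverse-cauchy x x#0)

abstract
  pointwise : ∀ {x y} → (∀ n → seq x n ≡ seq y n) → x ≈ y
  pointwise {x} {y} eq ε 0<ε = 0 , λ n _ → subst (ℚ._< ε)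
    (sym (trans (cong (λ z → ℚ.∣ seq x n ℚ.- z ∣) (sym (eq n))) (∣p-p∣≡0 (seq x n)))) 0<ε

  ≈-sym : ∀ {x y} → x ≈ y → y ≈ x
  ≈-sym {x} {y} e ε 0<ε = let N , p = e ε 0<ε in
    N , λ n le →
    subst (ℚ._< ε) (∣p-q∣≡∣q-p∣ (seq x n) (seq y n)) (p n le)

  ≈-trans : ∀ {x y z} → x ≈ y → y ≈ z → x ≈ z
  ≈-trans {x} {y} {z} e f ε 0<ε =
    both (λ n → triangle-< {ε} (seq x n) (seq y n) (seq z n))
      (e (ε ℚ.* ½) (0<ε½ ε 0<ε)) (f (ε ℚ.* ½) (0<ε½ ε 0<ε))

  +-cong : ∀ {x y u v} → x ≈ y → u ≈ v → x + u ≈ y + v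
  +-cong {x} {y} {u} {v} e f ε 0<ε =
    both (λ n → +-close {ε} (seq x n) (seq y n) (seq u n) (seq v n))
      (e (ε ℚ.* ½) (0<ε½ ε 0<ε)) (f (ε ℚ.* ½) (0<ε½ ε 0<ε))

  *-cong : ∀ {x y u v} → x ≈ y → u ≈ v → x * u ≈ y * v
  *-cong {x} {y} {u} {v} e f ε 0<ε =
    let M , 0<M , bd    = bounded₂ x v
        δ , 0<δ , close = *-close ε {M} 0<M 0<ε in
    both (λ n b (p , q) →
        close (seq x n) (seq y n) (seq u n) (seq v n) (proj₁ b) (proj₂ b) p q)
      bd (both (λ _ → _,_) (e δ 0<δ) (f δ 0<δ))

  -‿cong : ∀ {x y} → x ≈ y → - x ≈ - y
  -‿cong {x} {y} e ε 0<ε = let N , p = e ε 0<ε in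
    N , λ n le →
    subst (ℚ._< ε) (sym (neg-close (seq x n) (seq y n))) (p n le)

ℝ-commutativeRing : CommutativeRing 0ℓ 0ℓ
ℝ-commutativeRing = record
  { Carrier = ℝ
  ; _≈_ = _≈_
  ; _+_ = _+_
  ; _*_ = _*_
  ; -_  = -_
  ; 0#  = 0ℝ
  ; 1#  = 1ℝ
  ; isCommutativeRing = record
    { isRing = record
      { +-isAbelianGroup = record
        { isGroup = record
          { isMonoid = record
            { isSemigroup = record
              { isMagma = record
                { isEquivalence = record
                  { refl  = λ {x} → pointwise {x} {x} (λ _ → refl)
                  ; sym   = λ {x} {y} → ≈-sym {x} {y}
                  ; trans = λ {x} {y} {z} → ≈-trans {x} {y} {z}
                  }
                ; ∙-cong = λ {x} {y} {u} {v} → +-cong {x} {y} {u} {v}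
                }
              ; assoc = λ x y z → pointwise {(x + y) + z} {x + (y + z)}
                  λ n → ℚ.+-assoc (seq x n) (seq y n) (seq z n)
              }
            ; identity =
                (λ x → pointwise {0ℝ + x} {x} λ n → ℚ.+-identityˡ (seq x n)) ,
                (λ x → pointwise {x + 0ℝ} {x} λ n → ℚ.+-identityʳ (seq x n))
            }
          ; inverse =
              (λ x → pointwise {(- x) + x} {0ℝ} λ n → ℚ.+-inverseˡ (seq x n)) ,
              (λ x → pointwise {x + (- x)} {0ℝ} λ n → ℚ.+-inverseʳ (seq x n))
          ; ⁻¹-cong = λ {x} {y} → -‿cong {x} {y}
          }
        ; comm = λ x y → pointwise {x + y} {y + x}
            λ n → ℚ.+-comm (seq x n) (seq y n)
        }
      ; *-cong = λ {x} {y} {u} {v} → *-cong {x} {y} {u} {v}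
      ; *-assoc = λ x y z → pointwise {(x * y) * z} {x * (y * z)}
          λ n → ℚ.*-assoc (seq x n) (seq y n) (seq z n)
      ; *-identity =
          (λ x → pointwise {1ℝ * x} {x} λ n → ℚ.*-identityˡ (seq x n)) ,
          (λ x → pointwise {x * 1ℝ} {x} λ n → ℚ.*-identityʳ (seq x n))
      ; distrib =
          (λ x y z → pointwise {x * (y + z)} {x * y + x * z}
            λ n → ℚ.*-distribˡ-+ (seq x n) (seq y n) (seq z n)) ,
          (λ x y z → pointwise {(y + z) * x} {y * x + z * x}
            λ n → ℚ.*-distribʳ-+ (seq x n) (seq y n) (seq z n))
      }
    ; *-comm = λ x y → pointwise {x * y} {y * x} λ n → ℚ.*-comm (seq x n) (seq y n)
    }
  }

open RawSemiringDefinitions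
  (Semiring.rawSemiring (CommutativeRing.semiring ℝ-commutativeRing)) public
  using (_^_; sum)

-- ∑[ a ⋯ b ] f = f a + f (a + 1) + ⋯ + f b, empty when b < a.
∑[_⋯_] : ℕ → ℕ → (ℕ → ℝ) → ℝ
∑[ a ⋯ b ] f = sum {suc b ℕ.∸ a} (λ i → f (a ℕ.+ toℕ i))

record TaggedPartition (a b : ℝ) : Set where
  field
    size  : ℕ
    point : Fin (suc size) → ℝ
    tag   : Fin size → ℝ
    first : point fzero ≈ a
    last  : point (fromℕ size) ≈ b
    lower : ∀ i → point (inject₁ i) ≤ tag i
    upper : ∀ i → tag i ≤ point (fsuc i)

  width : Fin size → ℝ
  width i = point (fsuc i) - point (inject₁ i)

open TaggedPartition public

MeshAtMost : ∀ {a b} → ℝ → TaggedPartition a b → Set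
MeshAtMost δ P = ∀ i → width P i ≤ δ

riemannSum : ∀ {a b} → (ℝ → ℝ) → TaggedPartition a b → ℝ
riemannSum f P = sum (λ i → f (tag P i) * width P i)

-- I is the Riemann integral of f over [a , b]; meaningful for a ≤ b.
IsRiemannIntegral : (ℝ → ℝ) → ℝ → ℝ → ℝ → Set
IsRiemannIntegral f a b I =
  ∀ ε → 0ℝ < ε → ∃ λ δ → 0ℝ < δ ×
    ((P : TaggedPartition a b) → MeshAtMost δ P → ∣ riemannSum f P - I ∣ ≤ ε)

-- Oriented integral, with ∫ₐᵇ f = - ∫ᵇₐ f when b ≤ a.  The order of two reals
-- is not decidable, so I is required to be correct under either hypothesis;
-- since ¬ ¬ (a ≤ b ⊎ b ≤ a) and _≈_ is ¬¬-stable, I is still unique.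
IsIntegral : (ℝ → ℝ) → ℝ → ℝ → ℝ → Set
IsIntegral f a b I =
  (a ≤ b → IsRiemannIntegral f a b I) × (b ≤ a → IsRiemannIntegral f b a (- I))

-- g is a function on ℝ given by t ↦ f t / t for t # 0.  Its value at 0 is
-- arbitrary, which is immaterial for Riemann integration.
IsQuotientByVariable : (f g : ℝ → ℝ) → Set
IsQuotientByVariable f g =
  (∀ s t → s ≈ t → g s ≈ g t) × (∀ t (t#0 : t # 0ℝ) → g t ≈ f t * inverse t t#0)

-- (y)_{k,ƛ} = y (y - ƛ) ⋯ (y - (k - 1) ƛ)
degFalling : ℝ → ℝ → ℕ → ℝ
degFalling ƛ y zero    = 1ℝ
degFalling ƛ y (suc k) = degFalling ƛ y k * (y - fromNat k * ƛ)

-- (y)_k = y (y - 1) ⋯ (y - k + 1)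
falling : ℝ → ℕ → ℝ
falling y zero    = 1ℝ
falling y (suc k) = falling y k * (y - fromNat k)

-- The defining expansion determines S n k exactly for k ≤ n.
IsDegStirling₂ : ℝ → (ℕ → ℕ → ℝ) → Set
IsDegStirling₂ ƛ S =
  ∀ n y → degFalling ƛ y n ≈ ∑[ 0 ⋯ n ] (λ k → S n k * falling y k)

-- Formal power series in t, as coefficient sequences.
PowerSeries : Set
PowerSeries = ℕ → ℝ

infix  4 _≈ₚ_
infixl 6 _-ₚ_
infixl 7 _*ₚ_ _·ₚ_

_≈ₚ_ : PowerSeries → PowerSeries → Set
a ≈ₚ b = ∀ n → a n ≈ b n

1ₚ : PowerSeries
1ₚ zero    = 1ℝ
1ₚ (suc _) = 0ℝ

_-ₚ_ : PowerSeries → PowerSeries → PowerSeries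
(a -ₚ b) n = a n - b n

_·ₚ_ : ℝ → PowerSeries → PowerSeries
(c ·ₚ a) n = c * a n

_*ₚ_ : PowerSeries → PowerSeries → PowerSeries
(a *ₚ b) n = ∑[ 0 ⋯ n ] (λ k → a k * b (n ℕ.∸ k))

-- ∑ aₙ tⁿ / n!
egf : (ℕ → ℝ) → PowerSeries
egf a n = a n * fromℚ (ℚ._/_ (+ 1) (n !) {{ℕ._!≢0 n}})

degExp : ℝ → PowerSeries
degExp ƛ = egf (degFalling ƛ 1ℝ)

-- 1 / (1 - x (e_ƛ(t) - 1)) = ∑ Fₙ(x) tⁿ / n!, as formal power series in t;
-- the denominator has constant term 1, so it has a unique inverse.
IsDegFubini : ℝ → (ℕ → ℝ → ℝ) → Set
IsDegFubini ƛ F =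
  ∀ x → (1ₚ -ₚ x ·ₚ (degExp ƛ -ₚ 1ₚ)) *ₚ egf (λ n → F n x) ≈ₚ 1ₚ

{-# OPTIONS --safe #-}

-- Since the falling factorials are linearly independent, S is determined by
-- S(n+1,k) = S(n,k-1) + (k - nƛ) S(n,k).  By this recurrence the series
-- Cₖ = k! Σ S(n,k) tⁿ/n! satisfy e_ƛ(t) Cₖ = Cₖ + Cₖ₊₁, i.e. Cₖ = (e_ƛ(t) - 1)ᵏ,
-- whence F_n(x) = Σ S(n,k) k! xᵏ.  Weighting the recurrence by (k-1)! xᵏ and summing
-- over k gives the first identity.  Each sum Σ S(n,k) (k-1)! xᵏ is a primitive,
-- vanishing at 0, of the polynomial F_n(t)/t, so the second identity is the
-- first one once such polynomials are integrated.  The integrand is arbitrary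
-- at t = 0; only subintervals containing 0 see this, and they contribute at
-- most a multiple of the mesh.
module Submission where

open import Defs
open import Algebra.Bundles using (CommutativeRing)
open import Algebra.Bundles.Raw using (RawRing)
import Algebra.Properties.Semiring.Sum as SemiringSum
import Algebra.Solver.Ring as RingSolver
open import Algebra.Solver.Ring.AlmostCommutativeRing using (fromCommutativeRing; _-Raw-AlmostCommutative⟶_)
open import Data.Fin.Base using (Fin; toℕ; fromℕ; inject₁) renaming (zero to fzero; suc to fsuc)
import Data.Fin.Properties as Fin
open import Data.Integer.Base as ℤ using (+_)
import Data.Integer.Properties as ℤ
open import Data.Maybe.Base using (just; nothing)
open import Data.Nat.Base as ℕ using (ℕ; zero; suc; _∸_; _!; NonZero; z≤n; s≤s)
import Data.Nat.Properties as ℕ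
open import Data.Product.Base using (∃; ∃₂; _×_; _,_)
open import Data.Rational.Base as ℚ using (ℚ; 0ℚ; 1ℚ; ½)
import Data.Rational.Properties as ℚ
open import Data.Rational.Solver using (module +-*-Solver)
open import Data.Rational.Unnormalised.Base as ℚᵘ using (mkℚᵘ; *≡*)
import Data.Rational.Unnormalised.Properties as ℚᵘ
open import Data.Sum.Base using (inj₁; inj₂)
open import Level using (0ℓ)
open import Relation.Binary.Definitions using (WeaklyDecidable)
open import Relation.Binary.PropositionalEquality as ≡ using (_≡_; refl; cong; subst)
open import Relation.Nullary using (¬_; Dec; yes; no; contradiction)

-- `S` and `F` are given only through their defining relations, so each has to be identified with an
-- explicit family: `S n k` with `stirling` for `k ≤ n`, and `F n x` with `fubini` by cancelling,
-- for each `x`, a power series with constant term 1. The integral is shaped by what is undecidable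
-- about reals: whether a tag is `0`, hence which subintervals see the arbitrary value of the
-- integrand. The inequalities at stake are stable under double negation, so cases may be
-- distinguished while proving them, but no witness may depend on the case. Each local error is
-- therefore bounded by the increment of one fixed function, whatever the case; these increments
-- telescope over the partition, and δ is fixed before any case is considered. For the value at `0`
-- that function is a multiple of `clamp δ`. Primitives are described by an explicit error bound,
-- quadratic in the width of the subinterval, rather than by a derivative: δ can be computed from it
-- without a mean value theorem.

-- _≈_ and _≤_ unfold to function types, from which Agda cannot infer the reals
-- related; the record wrappers _≃_ and _≲_ restore this inference.
infix 4 _≃_

record _≃_ (x y : ℝ) : Set where
  constructor ⟪_⟫
  field unwrap : x ≈ y

open _≃_

pointwise-≃ : ∀ {x y} → (∀ n → seq x n ≡ seq y n) → x ≃ y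
pointwise-≃ {x} {y} eq = ⟪ pointwise {x} {y} eq ⟫

ℝ-ring : CommutativeRing 0ℓ 0ℓ
ℝ-ring = record
  { Carrier = ℝ
  ; _≈_ = _≃_
  ; _+_ = _+_
  ; _*_ = _*_
  ; -_  = -_
  ; 0#  = 0ℝ
  ; 1#  = 1ℝ
  ; isCommutativeRing = record
    { isRing = record
      { +-isAbelianGroup = record
        { isGroup = record
          { isMonoid = record
            { isSemigroup = record
              { isMagma = record
                { isEquivalence = record
                  { refl  = λ {x} → ⟪ R.refl {x} ⟫
                  ; sym   = λ {x} {y} e → ⟪ R.sym {x} {y} (unwrap e) ⟫
                  ; trans = λ {x} {y} {z} e f → ⟪ R.trans {x} {y} {z} (unwrap e) (unwrap f) ⟫
                  }
                ; ∙-cong = λ {x} {y} {u} {v} e f →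
                    ⟪ R.+-cong {x} {y} {u} {v} (unwrap e) (unwrap f) ⟫
                }
              ; assoc = λ x y z → ⟪ R.+-assoc x y z ⟫
              }
            ; identity = (λ x → ⟪ R.+-identityˡ x ⟫) , (λ x → ⟪ R.+-identityʳ x ⟫)
            }
          ; inverse = (λ x → ⟪ R.-‿inverseˡ x ⟫) , (λ x → ⟪ R.-‿inverseʳ x ⟫)
          ; ⁻¹-cong = λ {x} {y} e → ⟪ R.-‿cong {x} {y} (unwrap e) ⟫
          }
        ; comm = λ x y → ⟪ R.+-comm x y ⟫
        }
      ; *-cong = λ {x} {y} {u} {v} e f →
          ⟪ R.*-cong {x} {y} {u} {v} (unwrap e) (unwrap f) ⟫
      ; *-assoc = λ x y z → ⟪ R.*-assoc x y z ⟫
      ; *-identity = (λ x → ⟪ R.*-identityˡ x ⟫) , (λ x → ⟪ R.*-identityʳ x ⟫)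
      ; distrib = (λ x y z → ⟪ R.distribˡ x y z ⟫) , (λ x y z → ⟪ R.distribʳ x y z ⟫)
      }
    ; *-comm = λ x y → ⟪ R.*-comm x y ⟫
    }
  }
  where module R = CommutativeRing ℝ-commutativeRing

open CommutativeRing ℝ-ring
  using (setoid; semiring; reflexive; +-identityˡ; +-identityʳ; *-identityˡ; *-identityʳ)
  renaming ( refl to ≃-refl; sym to ≃-sym; trans to ≃-trans
           ; +-cong to +-cong-≃; +-congˡ to +-congˡ-≃; +-congʳ to +-congʳ-≃
           ; *-cong to *-cong-≃; *-congˡ to *-congˡ-≃; *-congʳ to *-congʳ-≃
           ; -‿cong to -‿cong-≃
           ; zeroˡ to *-zeroˡ; zeroʳ to *-zeroʳ)

open import Relation.Binary.Reasoning.Setoid setoid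

-- Ring solver for the reals with rational coefficients

ℚ-rawRing : RawRing 0ℓ 0ℓ
ℚ-rawRing = CommutativeRing.rawRing ℚ.+-*-commutativeRing

fromℚ-morphism : ℚ-rawRing -Raw-AlmostCommutative⟶ fromCommutativeRing ℝ-ring
fromℚ-morphism = record
  { ⟦_⟧    = fromℚ
  ; +-homo = λ _ _ → pointwise-≃ λ _ → refl
  ; *-homo = λ _ _ → pointwise-≃ λ _ → refl
  ; -‿homo = λ _ → pointwise-≃ λ _ → refl
  ; 0-homo = ≃-refl
  ; 1-homo = ≃-refl
  }

-- Equality of reals is undecidable, so the solver compares coefficients as rationals. Closed
-- constants such as `fromNat 0` evaluate to rational constants and so match `con 0ℚ`.
fromℚ-≟ : WeaklyDecidable (λ p q → fromℚ p ≃ fromℚ q)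
fromℚ-≟ p q with p ℚ.≟ q
... | yes refl = just ≃-refl
... | no  _    = nothing

module ℝ-Solver = RingSolver ℚ-rawRing (fromCommutativeRing ℝ-ring) fromℚ-morphism fromℚ-≟

open ℝ-Solver using (solve; _:=_; _:+_; _:*_; _:-_; :-_; con)

-- Inequalities between rationals

module Q = +-*-Solver

-- Reduces every linear rearrangement of an inequality to a ring identity between two differences,
-- which the solver checks. `≲-by` does the same for reals.
ℚ-≤-by : ∀ {a b c d} → b ℚ.- a ≡ d ℚ.- c → a ℚ.≤ b → c ℚ.≤ d
ℚ-≤-by {a} {b} {c} {d} eq a≤b = ≡.subst₂ ℚ._≤_
  (Q.solve 2 (λ a c → a Q.:+ (c Q.:- a) Q.:= c) refl a c)
  (≡.trans (Q.solve 3 (λ a b c → b Q.:+ (c Q.:- a) Q.:= (b Q.:- a) Q.:+ c) refl a b c)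
    (≡.trans (cong (ℚ._+ c) eq) (Q.solve 2 (λ c d → (d Q.:- c) Q.:+ c Q.:= d) refl c d)))
  (ℚ.+-monoˡ-≤ (c ℚ.- a) a≤b)

p≤∣p∣ : ∀ p → p ℚ.≤ ℚ.∣ p ∣
p≤∣p∣ p with ℚ.≤-total 0ℚ p
... | inj₁ 0≤p = ℚ.≤-reflexive (≡.sym (ℚ.0≤p⇒∣p∣≡p 0≤p))
... | inj₂ p≤0 = ℚ.≤-trans p≤0 (ℚ.0≤∣p∣ p)

∣p∣≤ : ∀ {p q} → p ℚ.≤ q → ℚ.- p ℚ.≤ q → ℚ.∣ p ∣ ℚ.≤ q
∣p∣≤ {p} {q} p≤q -p≤q with ℚ.∣p∣≡p∨∣p∣≡-p p
... | inj₁ e = subst (ℚ._≤ q) (≡.sym e) p≤q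
... | inj₂ e = subst (ℚ._≤ q) (≡.sym e) -p≤q

ε½<ε : ∀ {ε} → 0ℚ ℚ.< ε → ε ℚ.* ½ ℚ.< ε
ε½<ε {ε} 0<ε = ≡.subst₂ ℚ._<_ (ℚ.+-identityʳ (ε ℚ.* ½)) (½+½ ε)
  (ℚ.+-monoʳ-< (ε ℚ.* ½) (0<ε½ ε 0<ε))

-- The order of the reals

infix 4 _≲_

record _≲_ (x y : ℝ) : Set where
  constructor ⟪_⟫
  field unwrap-≤ : x ≤ y

open _≲_

pointwise-≲ : ∀ {x y} → (∀ n → seq x n ℚ.≤ seq y n) → x ≲ y
pointwise-≲ {x} {y} le = ⟪ (λ ε 0<ε → 0 , λ n _ →
  subst (ℚ._≤ seq y n ℚ.+ ε) (ℚ.+-identityʳ (seq x n)) (ℚ.+-mono-≤ (le n) (ℚ.<⇒≤ 0<ε))) ⟫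

≲-reflexive : ∀ {x y} → x ≃ y → x ≲ y
≲-reflexive {x} {y} ⟪ e ⟫ = ⟪ (λ ε 0<ε → let N , p = e ε 0<ε in N , λ n N≤n →
  ℚ-≤-by (Q.solve 3 (λ a b ε → ε Q.:- (a Q.:- b) Q.:= b Q.:+ ε Q.:- a) refl (seq x n) (seq y n) ε)
    (ℚ.≤-trans (p≤∣p∣ (seq x n ℚ.- seq y n)) (ℚ.<⇒≤ (p n N≤n)))) ⟫

≲-refl : ∀ {x} → x ≲ x
≲-refl = ≲-reflexive ≃-refl

≲-trans : ∀ {x y z} → x ≲ y → y ≲ z → x ≲ z
≲-trans {x} {y} {z} ⟪ p ⟫ ⟪ q ⟫ = ⟪ (λ ε 0<ε →
  both (λ n a b → ℚ-≤-by
      (≡.trans (Q.solve 4 (λ a b c h → (b Q.:+ h Q.:+ (c Q.:+ h)) Q.:- (a Q.:+ b) Q.:= c Q.:+ (h Q.:+ h) Q.:- a)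
         refl (seq x n) (seq y n) (seq z n) (ε ℚ.* ½))
        (cong (λ e → seq z n ℚ.+ e ℚ.- seq x n) (½+½ ε)))
      (ℚ.+-mono-≤ a b))
    (p (ε ℚ.* ½) (0<ε½ ε 0<ε)) (q (ε ℚ.* ½) (0<ε½ ε 0<ε))) ⟫

+-mono-≲ : ∀ {x y u v} → x ≲ y → u ≲ v → x + u ≲ y + v
+-mono-≲ {x} {y} {u} {v} ⟪ p ⟫ ⟪ q ⟫ = ⟪ (λ ε 0<ε →
  both (λ n a b → subst (seq x n ℚ.+ seq u n ℚ.≤_)
      (≡.trans (Q.solve 3 (λ a b h → a Q.:+ h Q.:+ (b Q.:+ h) Q.:= a Q.:+ b Q.:+ (h Q.:+ h))
         refl (seq y n) (seq v n) (ε ℚ.* ½))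
        (cong (seq y n ℚ.+ seq v n ℚ.+_) (½+½ ε)))
      (ℚ.+-mono-≤ a b))
    (p (ε ℚ.* ½) (0<ε½ ε 0<ε)) (q (ε ℚ.* ½) (0<ε½ ε 0<ε))) ⟫

≲-antisym : ∀ {x y} → x ≲ y → y ≲ x → x ≃ y
≲-antisym {x} {y} ⟪ p ⟫ ⟪ q ⟫ = ⟪ (λ ε 0<ε →
  both (λ n a b → ℚ.≤-<-trans
      (∣p∣≤
        (ℚ-≤-by (Q.solve 3 (λ a b h → b Q.:+ h Q.:- a Q.:= h Q.:- (a Q.:- b)) refl
          (seq x n) (seq y n) (ε ℚ.* ½)) a)
        (ℚ-≤-by (Q.solve 3 (λ a b h → a Q.:+ h Q.:- b Q.:= h Q.:- (Q.:- (a Q.:- b))) refl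
          (seq x n) (seq y n) (ε ℚ.* ½)) b))
      (ε½<ε 0<ε))
    (p (ε ℚ.* ½) (0<ε½ ε 0<ε)) (q (ε ℚ.* ½) (0<ε½ ε 0<ε))) ⟫

<⇒≴ : ∀ {x y} → x < y → ¬ y ≲ x
<⇒≴ {x} {y} (ε , 0<ε , x<y) ⟪ y≤x ⟫ =
  let N , p = both (λ _ → _,_) x<y (y≤x (ε ℚ.* ½) (0<ε½ ε 0<ε))
      a , b = p N ℕ.≤-refl
  in ℚ.<-irrefl refl (ℚ.<-≤-trans (ε½<ε 0<ε)
       (ℚ-≤-by (Q.solve 4 (λ x y e h → y Q.:+ (x Q.:+ h) Q.:- (x Q.:+ e Q.:+ y) Q.:= h Q.:- e)
          refl (seq x N) (seq y N) ε (ε ℚ.* ½))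
         (ℚ.+-mono-≤ a b)))

-- One rational comparison suffices. Let `z = y - x` vary by less than ε/4 from index `N` on. If
-- `z N ≤ ε/2`, then `z n ≤ ε` for all later `n`; otherwise `z n` stays above ε/4, which would
-- witness `x < y`.
≮⇒≳ : ∀ {x y} → ¬ x < y → y ≲ x
≮⇒≳ {x} {y} x≮y = ⟪ below ⟫
  where
  z : ℕ → ℚ
  z = seq (y - x)
  below : y ≤ x
  below ε 0<ε with cauchy (y - x) (ε ℚ.* ½ ℚ.* ½) (0<ε½ _ (0<ε½ ε 0<ε))
  ... | N , close = decide (z N ℚ.≤? h)
    where
    h k : ℚ
    h = ε ℚ.* ½
    k = h ℚ.* ½
    0<h : 0ℚ ℚ.< h
    0<h = 0<ε½ ε 0<ε
    near : ∀ m n → N ℕ.≤ m → N ℕ.≤ n → z m ℚ.- z n ℚ.≤ k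
    near m n N≤m N≤n = ℚ.≤-trans (p≤∣p∣ (z m ℚ.- z n)) (ℚ.<⇒≤ (close m n N≤m N≤n))
    decide : Dec (z N ℚ.≤ h) → Eventually λ n → seq y n ℚ.≤ seq x n ℚ.+ ε
    decide (yes zN≤h) = N , λ n N≤n → ℚ-≤-by
      (≡.trans
        (Q.solve 4 (λ x y z h → h Q.:+ h Q.:- (y Q.:- x Q.:- z Q.:+ z) Q.:= x Q.:+ (h Q.:+ h) Q.:- y)
          refl (seq x n) (seq y n) (z N) h)
        (cong (λ e → seq x n ℚ.+ e ℚ.- seq y n) (½+½ ε)))
      (ℚ.+-mono-≤ (ℚ.≤-trans (near n N N≤n ℕ.≤-refl) (ℚ.<⇒≤ (ε½<ε 0<h))) zN≤h)
    decide (no zN≰h) = contradiction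
      (k , 0<ε½ h 0<h , N , λ n N≤n → ℚ-≤-by
        (≡.trans (cong (λ e → z N ℚ.+ k ℚ.- (e ℚ.+ (z N ℚ.- z n))) (≡.sym (½+½ h)))
          (Q.solve 4 (λ x y z k → z Q.:+ k Q.:- (k Q.:+ k Q.:+ (z Q.:- (y Q.:- x))) Q.:= y Q.:- (x Q.:+ k))
            refl (seq x n) (seq y n) (z N) k))
        (ℚ.+-mono-≤ (ℚ.<⇒≤ (ℚ.≰⇒> zN≰h)) (near N n ℕ.≤-refl N≤n)))
      x≮y

-- _≲_ is ¬¬-stable, so its proofs may argue classically by cases.
≲-by-<-cases : ∀ {a b} x y → (x < y → a ≲ b) → (y ≲ x → a ≲ b) → a ≲ b
≲-by-<-cases x y lt ge = ≮⇒≳ λ b<a →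
  <⇒≴ b<a (ge (≮⇒≳ λ x<y → <⇒≴ b<a (lt x<y)))

<⇒≲ : ∀ {x y} → x < y → x ≲ y
<⇒≲ {x} {y} (δ , 0<δ , N , p) = ⟪ (λ ε 0<ε → N , λ n N≤n → ℚ.≤-trans
  (ℚ-≤-by (Q.solve 3 (λ x y d → y Q.:- (x Q.:+ d) Q.:= (y Q.:- d) Q.:- x) refl (seq x n) (seq y n) δ) (p n N≤n))
  (ℚ.+-monoʳ-≤ (seq y n) (ℚ.<⇒≤ (ℚ.<-trans (ℚ.neg-antimono-< 0<δ) 0<ε)))) ⟫

≲-by-cases : ∀ {a b} x y → (x ≲ y → a ≲ b) → (y ≲ x → a ≲ b) → a ≲ b
≲-by-cases x y le ge = ≲-by-<-cases x y (λ x<y → le (<⇒≲ x<y)) ge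

≲-by-#-cases : ∀ {a b} x y → (x # y → a ≲ b) → (x ≃ y → a ≲ b) → a ≲ b
≲-by-#-cases x y apart eq =
  ≲-by-<-cases x y (λ x<y → apart (inj₁ x<y)) λ y≲x →
  ≲-by-<-cases y x (λ y<x → apart (inj₂ y<x)) λ x≲y → eq (≲-antisym x≲y y≲x)

≲-respˡ : ∀ {x y z} → x ≃ y → x ≲ z → y ≲ z
≲-respˡ e le = ≲-trans (≲-reflexive (≃-sym e)) le

≲-respʳ : ∀ {x y z} → y ≃ z → x ≲ y → x ≲ z
≲-respʳ e le = ≲-trans le (≲-reflexive e)

≲-by : ∀ {a b c d} → b - a ≃ d - c → a ≲ b → c ≲ d
≲-by {a} {b} {c} {d} eq a≲b = ≲-respˡ
  (solve 2 (λ a c → a :+ (c :- a) := c) ≃-refl a c)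
  (≲-respʳ
    (≃-trans (solve 3 (λ a b c → b :+ (c :- a) := (b :- a) :+ c) ≃-refl a b c)
      (≃-trans (+-congʳ-≃ eq) (solve 2 (λ c d → (d :- c) :+ c := d) ≃-refl c d)))
    (+-mono-≲ a≲b ≲-refl))

-- Absolute values and products

∣∣-cong : ∀ {x y} → x ≃ y → ∣ x ∣ ≃ ∣ y ∣
∣∣-cong {x} {y} ⟪ e ⟫ = ⟪ (λ ε 0<ε → let N , p = e ε 0<ε in
  N , λ n N≤n → ℚ.≤-<-trans (abs-close (seq x n) (seq y n)) (p n N≤n)) ⟫

0≲∣x∣ : ∀ x → 0ℝ ≲ ∣ x ∣
0≲∣x∣ x = pointwise-≲ λ n → ℚ.0≤∣p∣ (seq x n)

x≲∣x∣ : ∀ x → x ≲ ∣ x ∣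
x≲∣x∣ x = pointwise-≲ λ n → p≤∣p∣ (seq x n)

∣x+y∣≲∣x∣+∣y∣ : ∀ x y → ∣ x + y ∣ ≲ ∣ x ∣ + ∣ y ∣
∣x+y∣≲∣x∣+∣y∣ x y = pointwise-≲ λ n → ℚ.∣p+q∣≤∣p∣+∣q∣ (seq x n) (seq y n)

∣x*y∣≃∣x∣*∣y∣ : ∀ x y → ∣ x * y ∣ ≃ ∣ x ∣ * ∣ y ∣
∣x*y∣≃∣x∣*∣y∣ x y = pointwise-≃ λ n → ℚ.∣p*q∣≡∣p∣*∣q∣ (seq x n) (seq y n)

∣-x∣≃∣x∣ : ∀ x → ∣ - x ∣ ≃ ∣ x ∣
∣-x∣≃∣x∣ x = pointwise-≃ λ n → ℚ.∣-p∣≡∣p∣ (seq x n)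

-x≲∣x∣ : ∀ x → - x ≲ ∣ x ∣
-x≲∣x∣ x = ≲-respʳ (∣-x∣≃∣x∣ x) (x≲∣x∣ (- x))

0≲x⇒∣x∣≃x : ∀ {x} → 0ℝ ≲ x → ∣ x ∣ ≃ x
0≲x⇒∣x∣≃x {x} 0≲x = ≲-antisym ∣x∣≲x (x≲∣x∣ x)
  where
  ∣x∣≲x : ∣ x ∣ ≲ x
  ∣x∣≲x = ⟪ (λ ε 0<ε →
    let N , p = unwrap-≤ 0≲x (ε ℚ.* ½) (0<ε½ ε 0<ε) in N , λ n N≤n →
    ∣p∣≤
      (subst (ℚ._≤ seq x n ℚ.+ ε) (ℚ.+-identityʳ (seq x n)) (ℚ.+-monoʳ-≤ (seq x n) (ℚ.<⇒≤ 0<ε)))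
      -- Adding `0 ≤ x n + ε/2` to itself gives `- x n ≤ x n + ε`.
      (ℚ-≤-by
        (≡.trans (Q.solve 2 (λ x h → x Q.:+ h Q.:+ (x Q.:+ h) Q.:- (Q.con 0ℚ Q.:+ Q.con 0ℚ)
              Q.:= x Q.:+ (h Q.:+ h) Q.:- (Q.:- x))
            refl (seq x n) (ε ℚ.* ½))
          (cong (λ e → seq x n ℚ.+ e ℚ.- (ℚ.- seq x n)) (½+½ ε)))
        (ℚ.+-mono-≤ (p n N≤n) (p n N≤n)))) ⟫

x≲0⇒∣x∣≃-x : ∀ {x} → x ≲ 0ℝ → ∣ x ∣ ≃ - x
x≲0⇒∣x∣≃-x {x} x≲0 = ≃-trans (≃-sym (∣-x∣≃∣x∣ x))
  (0≲x⇒∣x∣≃x (≲-by (solve 1 (λ x → con 0ℚ :- x := :- x :- con 0ℚ) ≃-refl x) x≲0))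

∣x∣≲ : ∀ {x y} → x ≲ y → - x ≲ y → ∣ x ∣ ≲ y
∣x∣≲ {x} x≲y -x≲y = ≲-by-cases 0ℝ x
  (λ 0≲x → ≲-respˡ (≃-sym (0≲x⇒∣x∣≃x 0≲x)) x≲y)
  (λ x≲0 → ≲-respˡ (≃-sym (x≲0⇒∣x∣≃-x x≲0)) -x≲y)

-- The product equals `∣ x ∣ * ∣ y ∣`, hence its own absolute value; no estimate on sequences is
-- required.
0≲x*y : ∀ {x y} → 0ℝ ≲ x → 0ℝ ≲ y → 0ℝ ≲ x * y
0≲x*y {x} {y} 0≲x 0≲y = ≲-respʳ
  (≃-trans (∣x*y∣≃∣x∣*∣y∣ x y) (*-cong-≃ (0≲x⇒∣x∣≃x 0≲x) (0≲x⇒∣x∣≃x 0≲y)))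
  (0≲∣x∣ (x * y))

*-monoˡ-≲ : ∀ {x y z} → 0ℝ ≲ z → x ≲ y → z * x ≲ z * y
*-monoˡ-≲ {x} {y} {z} 0≲z x≲y = ≲-by
  (solve 3 (λ x y z → z :* (y :- x) :- con 0ℚ := z :* y :- z :* x) ≃-refl x y z)
  (0≲x*y 0≲z (≲-by (solve 2 (λ x y → y :- x := y :- x :- con 0ℚ) ≃-refl x y) x≲y))

*-monoʳ-≲ : ∀ {x y z} → 0ℝ ≲ z → x ≲ y → x * z ≲ y * z
*-monoʳ-≲ {x} {y} {z} 0≲z x≲y = ≲-by
  (solve 3 (λ x y z → z :* y :- z :* x := y :* z :- x :* z) ≃-refl x y z) (*-monoˡ-≲ 0≲z x≲y)

*-mono-≲ : ∀ {x y u v} → 0ℝ ≲ x → 0ℝ ≲ v → x ≲ y → u ≲ v → x * u ≲ y * v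
*-mono-≲ 0≲x 0≲v x≲y u≲v = ≲-trans (*-monoˡ-≲ 0≲x u≲v) (*-monoʳ-≲ 0≲v x≲y)

-- Natural numbers in ℝ

-- The fraction `+ n / 1` is normalised by a gcd that is stuck on a variable `n`. Laws for `fromNat`
-- are therefore pulled back to unnormalised fractions, whose arithmetic computes.
fromℚᵘ-homo-+ : ∀ p q → ℚ.fromℚᵘ (p ℚᵘ.+ q) ≡ ℚ.fromℚᵘ p ℚ.+ ℚ.fromℚᵘ q
fromℚᵘ-homo-+ p q = ℚ.toℚᵘ-injective (ℚᵘ.≃-trans (ℚ.toℚᵘ-fromℚᵘ (p ℚᵘ.+ q))
  (ℚᵘ.≃-sym (ℚᵘ.≃-trans (ℚ.toℚᵘ-homo-+ (ℚ.fromℚᵘ p) (ℚ.fromℚᵘ q))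
    (ℚᵘ.+-cong (ℚ.toℚᵘ-fromℚᵘ p) (ℚ.toℚᵘ-fromℚᵘ q)))))

fromℚᵘ-homo-* : ∀ p q → ℚ.fromℚᵘ (p ℚᵘ.* q) ≡ ℚ.fromℚᵘ p ℚ.* ℚ.fromℚᵘ q
fromℚᵘ-homo-* p q = ℚ.toℚᵘ-injective (ℚᵘ.≃-trans (ℚ.toℚᵘ-fromℚᵘ (p ℚᵘ.* q))
  (ℚᵘ.≃-sym (ℚᵘ.≃-trans (ℚ.toℚᵘ-homo-* (ℚ.fromℚᵘ p) (ℚ.fromℚᵘ q))
    (ℚᵘ.*-cong (ℚ.toℚᵘ-fromℚᵘ p) (ℚ.toℚᵘ-fromℚᵘ q)))))

fromNat-+ : ∀ m n → fromNat (m ℕ.+ n) ≃ fromNat m + fromNat n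
fromNat-+ m n = pointwise-≃ λ _ → ≡.trans
  (cong (ℚ._/ 1) (≡.sym (≡.cong₂ ℤ._+_ (ℤ.*-identityʳ (+ m)) (ℤ.*-identityʳ (+ n)))))
  (fromℚᵘ-homo-+ (mkℚᵘ (+ m) 0) (mkℚᵘ (+ n) 0))

fromNat-* : ∀ m n → fromNat (m ℕ.* n) ≃ fromNat m * fromNat n
fromNat-* m n = pointwise-≃ λ _ → ≡.trans
  (cong (ℚ._/ 1) (ℤ.pos-* m n))
  (fromℚᵘ-homo-* (mkℚᵘ (+ m) 0) (mkℚᵘ (+ n) 0))

fromNat-suc : ∀ n → fromNat (suc n) ≃ 1ℝ + fromNat n
fromNat-suc n = fromNat-+ 1 n

fromNat-inverse : ∀ m .{{_ : NonZero m}} → fromNat m * fromℚ (+ 1 ℚ./ m) ≃ 1ℝ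
fromNat-inverse (suc m) = pointwise-≃ λ _ → ≡.trans
  (≡.sym (fromℚᵘ-homo-* (mkℚᵘ (+ suc m) 0) (mkℚᵘ (+ 1) m)))
  (ℚ.fromℚᵘ-cong {mkℚᵘ (+ suc m) 0 ℚᵘ.* mkℚᵘ (+ 1) m} {ℚᵘ.1ℚᵘ}
    (*≡* (≡.trans (ℤ.*-identityʳ (+ suc m ℤ.* + 1)) (≡.trans (ℤ.*-identityʳ (+ suc m))
      (≡.sym (≡.trans (ℤ.*-identityˡ _) (cong (λ k → + suc k) (ℕ.+-identityʳ m))))))))

fromNat-suc-cancelˡ : ∀ n {x y} → fromNat (suc n) * x ≃ fromNat (suc n) * y → x ≃ y
fromNat-suc-cancelˡ n {x} {y} eq = begin
  x           ≈⟨ unit x ⟨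
  r * (m * x) ≈⟨ *-congˡ-≃ eq ⟩
  r * (m * y) ≈⟨ unit y ⟩
  y           ∎
  where
  m r : ℝ
  m = fromNat (suc n)
  r = fromℚ (+ 1 ℚ./ suc n)
  unit : ∀ z → r * (m * z) ≃ z
  unit z = begin
    r * (m * z) ≈⟨ solve 3 (λ r m z → r :* (m :* z) := m :* r :* z) ≃-refl r m z ⟩
    m * r * z   ≈⟨ *-congʳ-≃ (fromNat-inverse (suc n)) ⟩
    1ℝ * z      ≈⟨ *-identityˡ z ⟩
    z           ∎

-- Estimates

∣x+y∣≲ : ∀ {x y a b} → ∣ x ∣ ≲ a → ∣ y ∣ ≲ b → ∣ x + y ∣ ≲ a + b
∣x+y∣≲ {x} {y} p q = ≲-trans (∣x+y∣≲∣x∣+∣y∣ x y) (+-mono-≲ p q)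

∣x*y∣≲ : ∀ {x y a b} → ∣ x ∣ ≲ a → ∣ y ∣ ≲ b → ∣ x * y ∣ ≲ a * b
∣x*y∣≲ {x} {y} p q = ≲-respˡ (≃-sym (∣x*y∣≃∣x∣*∣y∣ x y))
  (*-mono-≲ (0≲∣x∣ x) (≲-trans (0≲∣x∣ y) q) p q)

0≲x+y : ∀ {x y} → 0ℝ ≲ x → 0ℝ ≲ y → 0ℝ ≲ x + y
0≲x+y p q = ≲-respˡ (+-identityˡ 0ℝ) (+-mono-≲ p q)

x≲y⇒0≲y-x : ∀ {x y} → x ≲ y → 0ℝ ≲ y - x
x≲y⇒0≲y-x {x} {y} = ≲-by (solve 2 (λ x y → y :- x := y :- x :- con 0ℚ) ≃-refl x y)

x≃0⇒∣x∣≲ : ∀ {x y} → x ≃ 0ℝ → 0ℝ ≲ y → ∣ x ∣ ≲ y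
x≃0⇒∣x∣≲ x≃0 = ≲-respˡ (≃-sym (≃-trans (∣∣-cong x≃0) (0≲x⇒∣x∣≃x ≲-refl)))

∣∣-between : ∀ {a b y} → a ≲ y → y ≲ b → ∣ y ∣ ≲ ∣ a ∣ + ∣ b ∣
∣∣-between {a} {b} {y} a≲y y≲b = ∣x∣≲
  (≲-respˡ (+-identityˡ y) (+-mono-≲ (0≲∣x∣ a) (≲-trans y≲b (x≲∣x∣ b))))
  (≲-respˡ (+-identityʳ (- y)) (+-mono-≲
    (≲-trans (≲-by (solve 2 (λ a y → y :- a := :- a :- :- y) ≃-refl a y) a≲y) (-x≲∣x∣ a))
    (0≲∣x∣ b)))

0<fromℚ : ∀ {q} → 0ℚ ℚ.< q → 0ℝ < fromℚ q
0<fromℚ {q} 0<q = q , 0<q , 0 , λ _ _ → ℚ.≤-reflexive (ℚ.+-identityˡ q)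

0≲fromNat : ∀ n → 0ℝ ≲ fromNat n
0≲fromNat zero    = ≲-refl
0≲fromNat (suc n) = ≲-respʳ (≃-sym (fromNat-suc n))
  (0≲x+y (<⇒≲ (0<fromℚ (ℚ.positive⁻¹ 1ℚ))) (0≲fromNat n))

≤fromℚ : ∀ {x q} → (Eventually λ n → seq x n ℚ.≤ q) → x ≲ fromℚ q
≤fromℚ {x} {q} (N , p) = ⟪ (λ ε 0<ε → N , λ n N≤n →
  subst (ℚ._≤ q ℚ.+ ε) (ℚ.+-identityʳ (seq x n)) (ℚ.+-mono-≤ (p n N≤n) (ℚ.<⇒≤ 0<ε))) ⟫

fromℚ≤ : ∀ {x q} → (Eventually λ n → q ℚ.≤ seq x n) → fromℚ q ≲ x
fromℚ≤ {x} {q} (N , p) = ⟪ (λ ε 0<ε → N , λ n N≤n →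
  subst (ℚ._≤ seq x n ℚ.+ ε) (ℚ.+-identityʳ q) (ℚ.+-mono-≤ (p n N≤n) (ℚ.<⇒≤ 0<ε))) ⟫

-- The sign of `K` is unknown and `K` need not be invertible. A positive rational upper bound `C` of
-- `K` and a rational lower bound `e` of `ε` give the rational choice δ = e/C.
small-multiple : ∀ K ε → 0ℝ < ε → ∃ λ δ → 0ℝ < δ × K * δ ≲ ε
small-multiple K ε (e , 0<e , N , e≤ε) =
  let C , 0<C , M , K≤C = bounded K
      d , 0<d , Cd≡e    = 1/-cancel e 0<C
      0<δ = 0<fromℚ (0<d 0<e)
  in fromℚ d , 0<δ , (≲-trans
    (*-monoʳ-≲ (<⇒≲ 0<δ) (≤fromℚ (M , λ n M≤n → ℚ.≤-trans (p≤∣p∣ (seq K n)) (K≤C n M≤n))))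
    (≲-respˡ (pointwise-≃ λ _ → ≡.sym Cd≡e)
      (fromℚ≤ (N , λ n N≤n → subst (ℚ._≤ seq ε n) (ℚ.+-identityˡ e) (e≤ε n N≤n)))))

-- Finite sums

module Sum = SemiringSum semiring

-- Both kinds of bounded sum unfold to this one by computation: `∑[ 0 ⋯ n ] f` is `∑< (suc n) f`,
-- and `∑[ 1 ⋯ n ] f` is `∑< n` of `f` shifted by one.
∑< : ℕ → (ℕ → ℝ) → ℝ
∑< n f = sum {n} (λ i → f (toℕ i))

∑<-cong : ∀ n {f g} → (∀ k → k ℕ.< n → f k ≃ g k) → ∑< n f ≃ ∑< n g
∑<-cong n f≃g = Sum.sum-cong-≋ {n} λ i → f≃g (toℕ i) (Fin.toℕ<n i)

∑<-+ : ∀ n f g → ∑< n (λ k → f k + g k) ≃ ∑< n f + ∑< n g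
∑<-+ n f g = Sum.∑-distrib-+ {n} (λ i → f (toℕ i)) (λ i → g (toℕ i))

∑<-*ˡ : ∀ n c f → c * ∑< n f ≃ ∑< n (λ k → c * f k)
∑<-*ˡ n c f = Sum.*-distribˡ-sum {n} c (λ i → f (toℕ i))

∑<-*ʳ : ∀ n c f → ∑< n f * c ≃ ∑< n (λ k → f k * c)
∑<-*ʳ n c f = Sum.*-distribʳ-sum {n} c (λ i → f (toℕ i))

∑<-comm : ∀ m n (f : ℕ → ℕ → ℝ) → ∑< m (λ i → ∑< n (f i)) ≃ ∑< n (λ j → ∑< m (λ i → f i j))
∑<-comm m n f = Sum.∑-comm {m} {n} λ i j → f (toℕ i) (toℕ j)

∑<-zero : ∀ n {f} → (∀ k → k ℕ.< n → f k ≃ 0ℝ) → ∑< n f ≃ 0ℝ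
∑<-zero n f≃0 = ≃-trans (∑<-cong n f≃0) (Sum.sum-replicate-zero n)

∑<-truncate : ∀ {m n f} → m ℕ.≤ n → (∀ k → m ℕ.≤ k → f k ≃ 0ℝ) → ∑< n f ≃ ∑< m f
∑<-truncate {n = n} z≤n       f≃0 = ∑<-zero n λ k _ → f≃0 k z≤n
∑<-truncate         (s≤s m≤n) f≃0 = +-congˡ-≃ (∑<-truncate m≤n λ k m≤k → f≃0 (suc k) (s≤s m≤k))

∑<-last : ∀ n f → ∑< (suc n) f ≃ ∑< n f + f n
∑<-last zero    f = solve 1 (λ a → a :+ con 0ℚ := con 0ℚ :+ a) ≃-refl (f 0)
∑<-last (suc n) f = ≃-trans (+-congˡ-≃ (∑<-last n (λ k → f (suc k))))
  (solve 3 (λ a b c → a :+ (b :+ c) := a :+ b :+ c) ≃-refl (f 0) (∑< n (λ k → f (suc k))) (f (suc n)))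

-- Degenerate Stirling numbers by their recurrence

shift : (ℕ → ℝ) → ℕ → ℝ
shift a zero    = 0ℝ
shift a (suc k) = a k

stirling : ℝ → ℕ → ℕ → ℝ
stirling ƛ zero    zero    = 1ℝ
stirling ƛ zero    (suc k) = 0ℝ
stirling ƛ (suc n) k       = shift (stirling ƛ n) k + (fromNat k - fromNat n * ƛ) * stirling ƛ n k

stirling-vanish : ∀ ƛ {n k} → n ℕ.< k → stirling ƛ n k ≃ 0ℝ
stirling-vanish ƛ {zero}  {suc k} _ = ≃-refl
stirling-vanish ƛ {suc n} {suc k} (s≤s n<k) = begin
  stirling ƛ n k + c * stirling ƛ n (suc k)
    ≈⟨ +-cong-≃ (stirling-vanish ƛ n<k) (*-congˡ-≃ (stirling-vanish ƛ (ℕ.m<n⇒m<1+n n<k))) ⟩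
  0ℝ + c * 0ℝ
    ≈⟨ solve 1 (λ c → con 0ℚ :+ c :* con 0ℚ := con 0ℚ) ≃-refl c ⟩
  0ℝ ∎
  where
  c : ℝ
  c = fromNat (suc k) - fromNat n * ƛ

stirling-zero : ∀ ƛ n → .{{_ : NonZero n}} → stirling ƛ n 0 ≃ 0ℝ
stirling-zero ƛ (suc zero)    = solve 1 (λ ƛ → con 0ℚ :+ (con 0ℚ :- con 0ℚ :* ƛ) :* con 1ℚ := con 0ℚ) ≃-refl ƛ
stirling-zero ƛ (suc (suc n)) = ≃-trans (+-congˡ-≃ (*-congˡ-≃ (stirling-zero ƛ (suc n))))
  (solve 1 (λ c → con 0ℚ :+ c :* con 0ℚ := con 0ℚ) ≃-refl (fromNat 0 - fromNat (suc n) * ƛ))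

-- The weights are left arbitrary for two uses: `w = falling y` shows that `stirling` gives the
-- defining expansion, and `(k - 1)! xᵏ` gives the first identity.
∑-stirling-suc : ∀ ƛ n (w : ℕ → ℝ) →
  ∑< (suc (suc n)) (λ k → stirling ƛ (suc n) k * w k)
  ≃ ∑< (suc n) (λ k → stirling ƛ n k * w (suc k) + (fromNat k - fromNat n * ƛ) * (stirling ƛ n k * w k))
∑-stirling-suc ƛ n w = begin
  ∑< (suc (suc n)) (λ k → stirling ƛ (suc n) k * w k)
    ≈⟨ ∑<-cong (suc (suc n)) (λ k _ →
        solve 4 (λ s c t w → (s :+ c :* t) :* w := s :* w :+ c :* (t :* w)) ≃-refl
          (shift T k) (c k) (T k) (w k)) ⟩
  ∑< (suc (suc n)) (λ k → shift T k * w k + c k * (T k * w k))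
    ≈⟨ ∑<-+ (suc (suc n)) (λ k → shift T k * w k) (λ k → c k * (T k * w k)) ⟩
  0ℝ * w 0 + ∑< (suc n) (λ k → T k * w (suc k)) + ∑< (suc (suc n)) (λ k → c k * (T k * w k))
    ≈⟨ +-cong-≃
        (solve 2 (λ a s → con 0ℚ :* a :+ s := s) ≃-refl (w 0) (∑< (suc n) (λ k → T k * w (suc k))))
        (∑<-truncate {suc n} {suc (suc n)} {λ k → c k * (T k * w k)} (ℕ.n≤1+n (suc n)) λ k n<k →
          ≃-trans (*-congˡ-≃ (*-congʳ-≃ (stirling-vanish ƛ n<k)))
            (solve 2 (λ c w → c :* (con 0ℚ :* w) := con 0ℚ) ≃-refl (c k) (w k))) ⟩
  ∑< (suc n) (λ k → T k * w (suc k)) + ∑< (suc n) (λ k → c k * (T k * w k))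
    ≈⟨ ∑<-+ (suc n) (λ k → T k * w (suc k)) (λ k → c k * (T k * w k)) ⟨
  ∑< (suc n) (λ k → T k * w (suc k) + c k * (T k * w k)) ∎
  where
  T c : ℕ → ℝ
  T = stirling ƛ n
  c k = fromNat k - fromNat n * ƛ

-- Splitting the next factor as `y - nƛ = (y - k) + (k - nƛ)` raises the falling factorial in one
-- part and produces the coefficient of the recurrence in the other.
degFalling-stirling : ∀ ƛ y n →
  degFalling ƛ y n ≃ ∑< (suc n) (λ k → stirling ƛ n k * falling y k)
degFalling-stirling ƛ y zero = solve 0 (con 1ℚ := con 1ℚ :* con 1ℚ :+ con 0ℚ) ≃-refl
degFalling-stirling ƛ y (suc n) = begin
  degFalling ƛ y n * (y - fromNat n * ƛ)
    ≈⟨ *-congʳ-≃ (degFalling-stirling ƛ y n) ⟩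
  ∑< (suc n) (λ k → stirling ƛ n k * falling y k) * (y - fromNat n * ƛ)
    ≈⟨ ∑<-*ʳ (suc n) (y - fromNat n * ƛ) (λ k → stirling ƛ n k * falling y k) ⟩
  ∑< (suc n) (λ k → stirling ƛ n k * falling y k * (y - fromNat n * ƛ))
    ≈⟨ ∑<-cong (suc n) (λ k _ →
        solve 5 (λ t f y k m → t :* f :* (y :- m) := t :* (f :* (y :- k)) :+ (k :- m) :* (t :* f)) ≃-refl
          (stirling ƛ n k) (falling y k) y (fromNat k) (fromNat n * ƛ)) ⟩
  ∑< (suc n) (λ k → stirling ƛ n k * falling y (suc k) + (fromNat k - fromNat n * ƛ) * (stirling ƛ n k * falling y k))
    ≈⟨ ∑-stirling-suc ƛ n (falling y) ⟨
  ∑< (suc (suc n)) (λ k → stirling ƛ (suc n) k * falling y k) ∎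

falling-cong : ∀ {y z} k → y ≃ z → falling y k ≃ falling z k
falling-cong zero    e = ≃-refl
falling-cong (suc k) e = *-cong-≃ (falling-cong k e) (+-congʳ-≃ e)

falling-0 : ∀ k → falling 0ℝ (suc k) ≃ 0ℝ
falling-0 zero    = solve 0 (con 1ℚ :* (con 0ℚ :- con 0ℚ) := con 0ℚ) ≃-refl
falling-0 (suc k) = ≃-trans (*-congʳ-≃ (falling-0 k)) (*-zeroˡ (0ℝ - fromNat (suc k)))

-- The definition peels off the last factor; here the first one is peeled off, which is common to
-- all terms of positive degree.
falling-1+ : ∀ y k → falling (1ℝ + y) (suc k) ≃ (1ℝ + y) * falling y k
falling-1+ y zero    = solve 1 (λ y → con 1ℚ :* (con 1ℚ :+ y :- con 0ℚ) := (con 1ℚ :+ y) :* con 1ℚ) ≃-refl y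
falling-1+ y (suc k) = begin
  falling (1ℝ + y) (suc k) * (1ℝ + y - fromNat (suc k))
    ≈⟨ *-cong-≃ (falling-1+ y k) (+-congˡ-≃ (-‿cong-≃ (fromNat-suc k))) ⟩
  (1ℝ + y) * falling y k * (1ℝ + y - (1ℝ + fromNat k))
    ≈⟨ solve 3 (λ y f k → (con 1ℚ :+ y) :* f :* (con 1ℚ :+ y :- (con 1ℚ :+ k)) := (con 1ℚ :+ y) :* (f :* (y :- k)))
         ≃-refl y (falling y k) (fromNat k) ⟩
  (1ℝ + y) * (falling y k * (y - fromNat k)) ∎

-- Evaluating at y = 0 isolates the constant coefficient; at y = m + 1 the
-- remaining terms share the nonzero factor m + 1.
falling-independent : ∀ n (d : ℕ → ℝ) →
  (∀ m → ∑< n (λ k → d k * falling (fromNat m) k) ≃ 0ℝ) → ∀ k → k ℕ.< n → d k ≃ 0ℝ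
falling-independent (suc n) d vanishes = λ where
    zero    _         → d0≃0
    (suc k) (s≤s k<n) → falling-independent n (λ k → d (suc k)) tail k k<n
  where
  d0≃0 : d 0 ≃ 0ℝ
  d0≃0 = begin
    d 0
      ≈⟨ solve 1 (λ d → d := d :* con 1ℚ :+ con 0ℚ) ≃-refl (d 0) ⟩
    d 0 * 1ℝ + 0ℝ
      ≈⟨ +-congˡ-≃ (∑<-zero n λ k _ → ≃-trans (*-congˡ-≃ (falling-0 k)) (*-zeroʳ (d (suc k)))) ⟨
    d 0 * 1ℝ + ∑< n (λ k → d (suc k) * falling (fromNat 0) (suc k))
      ≈⟨ vanishes 0 ⟩
    0ℝ ∎
  tail : ∀ m → ∑< n (λ k → d (suc k) * falling (fromNat m) k) ≃ 0ℝ
  tail m = fromNat-suc-cancelˡ m (begin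
    fromNat (suc m) * ∑< n (λ k → d (suc k) * falling (fromNat m) k)
      ≈⟨ ∑<-*ˡ n (fromNat (suc m)) (λ k → d (suc k) * falling (fromNat m) k) ⟩
    ∑< n (λ k → fromNat (suc m) * (d (suc k) * falling (fromNat m) k))
      ≈⟨ ∑<-cong n (λ k _ → begin
          fromNat (suc m) * (d (suc k) * falling (fromNat m) k)
            ≈⟨ *-congʳ-≃ (fromNat-suc m) ⟩
          (1ℝ + fromNat m) * (d (suc k) * falling (fromNat m) k)
            ≈⟨ solve 3 (λ m d f → m :* (d :* f) := d :* (m :* f)) ≃-refl
                 (1ℝ + fromNat m) (d (suc k)) (falling (fromNat m) k) ⟩
          d (suc k) * ((1ℝ + fromNat m) * falling (fromNat m) k)
            ≈⟨ *-congˡ-≃ (falling-1+ (fromNat m) k) ⟨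
          d (suc k) * falling (1ℝ + fromNat m) (suc k)
            ≈⟨ *-congˡ-≃ (falling-cong (suc k) (fromNat-suc m)) ⟨
          d (suc k) * falling (fromNat (suc m)) (suc k) ∎) ⟩
    rest
      ≈⟨ solve 1 (λ s → s := con 0ℚ :* con 1ℚ :+ s) ≃-refl rest ⟩
    0ℝ * 1ℝ + rest
      ≈⟨ +-congʳ-≃ (*-congʳ-≃ d0≃0) ⟨
    d 0 * 1ℝ + rest
      ≈⟨ vanishes (suc m) ⟩
    0ℝ
      ≈⟨ *-zeroʳ (fromNat (suc m)) ⟨
    fromNat (suc m) * 0ℝ ∎)
    where
    rest : ℝ
    rest = ∑< n (λ k → d (suc k) * falling (fromNat (suc m)) (suc k))

-- Both families expand `degFalling ƛ y n`, so their differences are the coefficients of a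
-- combination of falling factorials that vanishes at every natural `y`.
degStirling₂-unique : ∀ ƛ S → IsDegStirling₂ ƛ S → ∀ n k → k ℕ.≤ n → S n k ≃ stirling ƛ n k
degStirling₂-unique ƛ S isS n k k≤n = begin
  S n k                                    ≈⟨ solve 2 (λ s t → s := (s :- t) :+ t) ≃-refl (S n k) (T k) ⟩
  (S n k - T k) + T k                      ≈⟨ +-congʳ-≃ (falling-independent (suc n) (λ k → S n k - T k)
                                                            vanishes k (s≤s k≤n)) ⟩
  0ℝ + T k                                 ≈⟨ +-identityˡ (T k) ⟩
  T k                                      ∎
  where
  T : ℕ → ℝ
  T = stirling ƛ n
  vanishes : ∀ m → ∑< (suc n) (λ k → (S n k - T k) * falling (fromNat m) k) ≃ 0ℝ
  vanishes m = begin
    ∑< (suc n) (λ k → (S n k - T k) * f k)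
      ≈⟨ ∑<-cong (suc n) (λ k _ →
           solve 3 (λ s t f → (s :- t) :* f := s :* f :+ con (ℚ.- 1ℚ) :* (t :* f)) ≃-refl (S n k) (T k) (f k)) ⟩
    ∑< (suc n) (λ k → S n k * f k + -1ℝ * (T k * f k))
      ≈⟨ ∑<-+ (suc n) (λ k → S n k * f k) (λ k → -1ℝ * (T k * f k)) ⟩
    ∑< (suc n) (λ k → S n k * f k) + ∑< (suc n) (λ k → -1ℝ * (T k * f k))
      ≈⟨ +-cong-≃ ⟪ isS n (fromNat m) ⟫ (∑<-*ˡ (suc n) -1ℝ (λ k → T k * f k)) ⟨
    degFalling ƛ (fromNat m) n + -1ℝ * ∑< (suc n) (λ k → T k * f k)
      ≈⟨ +-congˡ-≃ (*-congˡ-≃ (degFalling-stirling ƛ (fromNat m) n)) ⟨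
    degFalling ƛ (fromNat m) n + -1ℝ * degFalling ƛ (fromNat m) n
      ≈⟨ solve 1 (λ d → d :+ con (ℚ.- 1ℚ) :* d := con 0ℚ) ≃-refl (degFalling ƛ (fromNat m) n) ⟩
    0ℝ ∎
    where
    f : ℕ → ℝ
    f = falling (fromNat m)
    -1ℝ : ℝ
    -1ℝ = fromℚ (ℚ.- 1ℚ)

-- Power series

invFact : ℕ → ℝ
invFact n = fromℚ (ℚ._/_ (+ 1) (n !) {{ℕ._!≢0 n}})

fromNat-!-invFact : ∀ n → fromNat (n !) * invFact n ≃ 1ℝ
fromNat-!-invFact n = fromNat-inverse (n !) {{ℕ._!≢0 n}}

invFact-suc : ∀ n → fromNat (suc n) * invFact (suc n) ≃ invFact n
invFact-suc n = begin
  m * r′               ≈⟨ *-identityʳ (m * r′) ⟨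
  m * r′ * 1ℝ          ≈⟨ *-congˡ-≃ (fromNat-!-invFact n) ⟨
  m * r′ * (f * r)     ≈⟨ solve 4 (λ m r′ f r → m :* r′ :* (f :* r) := m :* f :* r′ :* r) ≃-refl m r′ f r ⟩
  m * f * r′ * r       ≈⟨ *-congʳ-≃ (*-congʳ-≃ (fromNat-* (suc n) (n !))) ⟨
  fromNat (suc n !) * r′ * r ≈⟨ *-congʳ-≃ (fromNat-!-invFact (suc n)) ⟩
  1ℝ * r               ≈⟨ *-identityˡ r ⟩
  r                    ∎
  where
  m r′ f r : ℝ
  m  = fromNat (suc n)
  r′ = invFact (suc n)
  f  = fromNat (n !)
  r  = invFact n

egf-injective : ∀ u v n → egf u n ≃ egf v n → u n ≃ v n
egf-injective u v n eq = begin
  u n                             ≈⟨ unit (u n) ⟨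
  fromNat (n !) * (u n * invFact n) ≈⟨ *-congˡ-≃ eq ⟩
  fromNat (n !) * (v n * invFact n) ≈⟨ unit (v n) ⟩
  v n                             ∎
  where
  unit : ∀ z → fromNat (n !) * (z * invFact n) ≃ z
  unit z = begin
    fromNat (n !) * (z * invFact n)
      ≈⟨ solve 3 (λ f z r → f :* (z :* r) := z :* (f :* r)) ≃-refl (fromNat (n !)) z (invFact n) ⟩
    z * (fromNat (n !) * invFact n) ≈⟨ *-congˡ-≃ (fromNat-!-invFact n) ⟩
    z * 1ℝ                          ≈⟨ *-identityʳ z ⟩
    z                               ∎

∂ : PowerSeries → PowerSeries
∂ u n = fromNat (suc n) * u (suc n)

∂-egf : ∀ u n → ∂ (egf u) n ≃ u (suc n) * invFact n
∂-egf u n = begin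
  fromNat (suc n) * (u (suc n) * invFact (suc n))
    ≈⟨ solve 3 (λ m u r → m :* (u :* r) := u :* (m :* r)) ≃-refl (fromNat (suc n)) (u (suc n)) (invFact (suc n)) ⟩
  u (suc n) * (fromNat (suc n) * invFact (suc n))
    ≈⟨ *-congˡ-≃ (invFact-suc n) ⟩
  u (suc n) * invFact n ∎

-- The factor `n + 1` splits as `j + (n + 1 - j)` in each term of the convolution. The term `j = 0`
-- drops out of one half and `j = n + 1` out of the other.
∂-*ₚ : ∀ u v n → ∂ (u *ₚ v) n ≃ (∂ u *ₚ v) n + (u *ₚ ∂ v) n
∂-*ₚ u v n = begin
  fromNat (suc n) * ∑< (suc (suc n)) (λ j → u j * v (suc n ∸ j))
    ≈⟨ ∑<-*ˡ (suc (suc n)) (fromNat (suc n)) (λ j → u j * v (suc n ∸ j)) ⟩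
  ∑< (suc (suc n)) (λ j → fromNat (suc n) * (u j * v (suc n ∸ j)))
    ≈⟨ ∑<-cong (suc (suc n)) (λ j j<2+n → begin
        fromNat (suc n) * (u j * v (suc n ∸ j))
          ≡⟨ cong (λ m → fromNat m * (u j * v (suc n ∸ j))) (ℕ.m+[n∸m]≡n (ℕ.≤-pred j<2+n)) ⟨
        fromNat (j ℕ.+ (suc n ∸ j)) * (u j * v (suc n ∸ j))
          ≈⟨ *-congʳ-≃ (fromNat-+ j (suc n ∸ j)) ⟩
        (fromNat j + fromNat (suc n ∸ j)) * (u j * v (suc n ∸ j))
          ≈⟨ solve 4 (λ j i u v → (j :+ i) :* (u :* v) := j :* u :* v :+ u :* (i :* v)) ≃-refl
               (fromNat j) (fromNat (suc n ∸ j)) (u j) (v (suc n ∸ j)) ⟩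
        l j + r j ∎) ⟩
  ∑< (suc (suc n)) (λ j → l j + r j)
    ≈⟨ ∑<-+ (suc (suc n)) l r ⟩
  (l 0 + (∂ u *ₚ v) n) + ∑< (suc (suc n)) r
    ≈⟨ +-cong-≃
        (solve 3 (λ a b c → con 0ℚ :* a :* b :+ c := c) ≃-refl (u 0) (v (suc n)) ((∂ u *ₚ v) n))
        (begin
          ∑< (suc (suc n)) r
            ≈⟨ ∑<-last (suc n) r ⟩
          ∑< (suc n) r + u (suc n) * (fromNat (n ∸ n) * v (n ∸ n))
            ≡⟨ cong (λ i → ∑< (suc n) r + u (suc n) * (fromNat i * v (n ∸ n))) (ℕ.n∸n≡0 n) ⟩
          ∑< (suc n) r + u (suc n) * (0ℝ * v (n ∸ n))
            ≈⟨ solve 3 (λ s a b → s :+ a :* (con 0ℚ :* b) := s) ≃-refl (∑< (suc n) r) (u (suc n)) (v (n ∸ n)) ⟩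
          ∑< (suc n) r
            ≈⟨ ∑<-cong (suc n) {r} {λ j → u j * ∂ v (n ∸ j)} (λ j j<1+n → *-congˡ-≃ (reflexive
                 (cong (λ i → fromNat i * v i) (ℕ.+-∸-assoc 1 (ℕ.≤-pred j<1+n))))) ⟩
          (u *ₚ ∂ v) n ∎) ⟩
  (∂ u *ₚ v) n + (u *ₚ ∂ v) n ∎
  where
  l r : ℕ → ℝ
  l j = fromNat j * u j * v (suc n ∸ j)
  r j = u j * (fromNat (suc n ∸ j) * v (suc n ∸ j))

1ₚ-identityˡ : ∀ u n → (1ₚ *ₚ u) n ≃ u n
1ₚ-identityˡ u n = begin
  1ℝ * u n + ∑< n (λ j → 0ℝ * u (n ∸ suc j))
    ≈⟨ +-congˡ-≃ (∑<-zero n λ j _ → *-zeroˡ (u (n ∸ suc j))) ⟩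
  1ℝ * u n + 0ℝ
    ≈⟨ solve 1 (λ u → con 1ℚ :* u :+ con 0ℚ := u) ≃-refl (u n) ⟩
  u n ∎

-- Since the leading coefficient is 1, coefficient `n` of a product determines `u n` from the
-- earlier coefficients. The bound `N` in `below` turns this strong induction into a structural one.
*ₚ-cancelˡ : ∀ d u v → d 0 ≃ 1ℝ → (∀ n → (d *ₚ u) n ≃ (d *ₚ v) n) → ∀ n → u n ≃ v n
*ₚ-cancelˡ d u v d0≃1 eq n = below (suc n) n ℕ.≤-refl
  where
  rest : PowerSeries → ℕ → ℝ
  rest w n = ∑< n (λ j → d (suc j) * w (n ∸ suc j))
  split : ∀ w n → (d *ₚ w) n ≃ w n + rest w n
  split w n = +-congʳ-≃ (≃-trans (*-congʳ-≃ d0≃1) (*-identityˡ (w n)))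
  below : ∀ N n → n ℕ.< N → u n ≃ v n
  below (suc N) n (s≤s n≤N) = begin
    u n                       ≈⟨ solve 2 (λ a b → a := a :+ b :- b) ≃-refl (u n) (rest u n) ⟩
    u n + rest u n - rest u n ≈⟨ +-cong-≃ (≃-trans (≃-sym (split u n)) (≃-trans (eq n) (split v n)))
                                   (-‿cong-≃ (∑<-cong n
                                     {λ j → d (suc j) * u (n ∸ suc j)} {λ j → d (suc j) * v (n ∸ suc j)} λ j j<n → *-congˡ-≃ (below N (n ∸ suc j)
                                     (ℕ.<-≤-trans (ℕ.∸-monoʳ-< (s≤s z≤n) j<n) n≤N)))) ⟩
    v n + rest v n - rest v n ≈⟨ solve 2 (λ a b → a :+ b :- b := a) ≃-refl (v n) (rest v n) ⟩
    v n                       ∎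

-- The Fubini polynomials

-- Coefficient form of the differential equation `(1 + ƛt) e′ = e`.
∂-degExp : ∀ ƛ n → ∂ (degExp ƛ) n ≃ (1ℝ - fromNat n * ƛ) * degExp ƛ n
∂-degExp ƛ n = ≃-trans (∂-egf (degFalling ƛ 1ℝ) n)
  (solve 3 (λ a b c → a :* b :* c := b :* (a :* c)) ≃-refl
    (degFalling ƛ 1ℝ n) (1ℝ - fromNat n * ƛ) (invFact n))

-- The power series (e_ƛ(t) - 1)ᵏ.
column : ℝ → ℕ → PowerSeries
column ƛ k = egf (λ n → stirling ƛ n k * fromNat (k !))

-- Set to zero for `k = 0`, where it only occurs multiplied by `k`.
prevColumn : ℝ → ℕ → PowerSeries
prevColumn ƛ k n = shift (λ j → column ƛ j n) k

-- The Stirling recurrence multiplied by `k!/n!`; as a differential equation,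
-- `(1 + ƛt) Cₖ′ = k Cₖ₋₁ + k Cₖ`.
∂-column : ∀ ƛ k n →
  ∂ (column ƛ k) n ≃ fromNat k * prevColumn ƛ k n + (fromNat k - fromNat n * ƛ) * column ƛ k n
∂-column ƛ zero n = ≃-trans (∂-egf (λ n → stirling ƛ n 0 * fromNat 1) n)
  (solve 4 (λ c t f r → (con 0ℚ :+ c :* t) :* f :* r := con 0ℚ :* con 0ℚ :+ c :* (t :* f :* r)) ≃-refl
    (fromNat 0 - fromNat n * ƛ) (stirling ƛ n 0) (fromNat 1) (invFact n))
∂-column ƛ (suc k) n = begin
  ∂ (column ƛ (suc k)) n
    ≈⟨ ∂-egf (λ n → stirling ƛ n (suc k) * fromNat (suc k !)) n ⟩
  (s + c * t) * fromNat (suc k !) * r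
    ≈⟨ solve 5 (λ s c t f r → (s :+ c :* t) :* f :* r := s :* f :* r :+ c :* (t :* f :* r)) ≃-refl
         s c t (fromNat (suc k !)) r ⟩
  s * fromNat (suc k !) * r + c * column ƛ (suc k) n
    ≈⟨ +-congʳ-≃ (≃-trans (*-congʳ-≃ (*-congˡ-≃ (fromNat-* (suc k) (k !))))
         (solve 4 (λ s m f r → s :* (m :* f) :* r := m :* (s :* f :* r)) ≃-refl
           s (fromNat (suc k)) (fromNat (k !)) r)) ⟩
  fromNat (suc k) * column ƛ k n + c * column ƛ (suc k) n ∎
  where
  s c t r : ℝ
  s = stirling ƛ n k
  c = fromNat (suc k) - fromNat n * ƛ
  t = stirling ƛ n (suc k)
  r = invFact n

-- This is (e_ƛ(t) - 1) · (e_ƛ(t) - 1)ᵏ = (e_ƛ(t) - 1)ᵏ⁺¹: both sides satisfy the same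
-- first-order differential equation, i.e. recurrence in n.
degExp-column : ∀ ƛ n k → (degExp ƛ *ₚ column ƛ k) n ≃ column ƛ k n + column ƛ (suc k) n
degExp-column ƛ zero k = begin
  degExp ƛ 0 * column ƛ k 0 + 0ℝ
    ≈⟨ +-congʳ-≃ (*-congʳ-≃ (pointwise-≃ {degExp ƛ 0} {1ℝ} λ _ → refl)) ⟩
  1ℝ * column ƛ k 0 + 0ℝ
    ≈⟨ solve 3 (λ c f r → con 1ℚ :* c :+ con 0ℚ := c :+ con 0ℚ :* f :* r) ≃-refl
         (column ƛ k 0) (fromNat (suc k !)) (invFact 0) ⟩
  column ƛ k 0 + column ƛ (suc k) 0 ∎
degExp-column ƛ (suc n) k = fromNat-suc-cancelˡ n (begin
  ∂ (e *ₚ c) n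
    ≈⟨ ∂-*ₚ e c n ⟩
  (∂ e *ₚ c) n + (e *ₚ ∂ c) n
    ≈⟨ ∑<-+ (suc n) (λ j → ∂ e j * c (n ∸ j)) (λ j → e j * ∂ c (n ∸ j)) ⟨
  ∑< (suc n) (λ j → ∂ e j * c (n ∸ j) + e j * ∂ c (n ∸ j))
    ≈⟨ ∑<-cong (suc n) (λ j j<1+n → begin
        ∂ e j * c (n ∸ j) + e j * ∂ c (n ∸ j)
          ≈⟨ +-cong-≃ (*-congʳ-≃ (∂-degExp ƛ j)) (*-congˡ-≃ (∂-column ƛ k (n ∸ j))) ⟩
        (1ℝ - fromNat j * ƛ) * e j * c (n ∸ j) + e j * (K * p (n ∸ j) + (K - fromNat (n ∸ j) * ƛ) * c (n ∸ j))
          ≈⟨ solve 7 (λ j i ƛ e c k p →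
               (con 1ℚ :- j :* ƛ) :* e :* c :+ e :* (k :* p :+ (k :- i :* ƛ) :* c)
               := (con 1ℚ :+ k :- (j :+ i) :* ƛ) :* (e :* c) :+ k :* (e :* p)) ≃-refl
               (fromNat j) (fromNat (n ∸ j)) ƛ (e j) (c (n ∸ j)) K (p (n ∸ j)) ⟩
        (1ℝ + K - (fromNat j + fromNat (n ∸ j)) * ƛ) * (e j * c (n ∸ j)) + K * (e j * p (n ∸ j))
          -- The indices of the two factors add up to `n`, so the coefficient becomes the constant
          -- `a` and can leave the sum.
          ≈⟨ +-congʳ-≃ (*-congʳ-≃ (+-congˡ-≃ (-‿cong-≃ (*-congʳ-≃ (begin
               fromNat j + fromNat (n ∸ j) ≈⟨ fromNat-+ j (n ∸ j) ⟨
               fromNat (j ℕ.+ (n ∸ j))     ≡⟨ cong fromNat (ℕ.m+[n∸m]≡n (ℕ.≤-pred j<1+n)) ⟩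
               fromNat n                   ∎))))) ⟩
        a * (e j * c (n ∸ j)) + K * (e j * p (n ∸ j)) ∎) ⟩
  ∑< (suc n) (λ j → a * (e j * c (n ∸ j)) + K * (e j * p (n ∸ j)))
    ≈⟨ ∑<-+ (suc n) (λ j → a * (e j * c (n ∸ j))) (λ j → K * (e j * p (n ∸ j))) ⟩
  ∑< (suc n) (λ j → a * (e j * c (n ∸ j))) + ∑< (suc n) (λ j → K * (e j * p (n ∸ j)))
    ≈⟨ +-cong-≃ (∑<-*ˡ (suc n) a (λ j → e j * c (n ∸ j))) (∑<-*ˡ (suc n) K (λ j → e j * p (n ∸ j))) ⟨
  a * (e *ₚ c) n + K * (e *ₚ p) n
    -- The induction is on `n`, so the hypothesis is available for column `k` and for column `k - 1`
    -- alike.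
    ≈⟨ +-cong-≃ (*-congˡ-≃ (degExp-column ƛ n k)) (prev k) ⟩
  a * (c n + c⁺ n) + K * (p n + c n)
    ≈⟨ solve 6 (λ k m ƛ c c⁺ p →
         (con 1ℚ :+ k :- m :* ƛ) :* (c :+ c⁺) :+ k :* (p :+ c)
         := (k :* p :+ (k :- m :* ƛ) :* c) :+ ((con 1ℚ :+ k) :* c :+ (con 1ℚ :+ k :- m :* ƛ) :* c⁺)) ≃-refl
         K (fromNat n) ƛ (c n) (c⁺ n) (p n) ⟩
  (K * p n + (K - fromNat n * ƛ) * c n) + ((1ℝ + K) * c n + (1ℝ + K - fromNat n * ƛ) * c⁺ n)
    ≈⟨ +-cong-≃ (∂-column ƛ k n) (≃-trans (∂-column ƛ (suc k) n)
         (+-cong-≃ (*-congʳ-≃ (fromNat-suc k)) (*-congʳ-≃ (+-congʳ-≃ (fromNat-suc k))))) ⟨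
  ∂ c n + ∂ c⁺ n
    ≈⟨ solve 3 (λ m a b → m :* a :+ m :* b := m :* (a :+ b)) ≃-refl (fromNat (suc n)) (c (suc n)) (c⁺ (suc n)) ⟩
  fromNat (suc n) * (c (suc n) + c⁺ (suc n)) ∎)
  where
  e c c⁺ p : PowerSeries
  e  = degExp ƛ
  c  = column ƛ k
  c⁺ = column ƛ (suc k)
  p  = prevColumn ƛ k
  K a : ℝ
  K = fromNat k
  a = 1ℝ + K - fromNat n * ƛ
  prev : ∀ k → fromNat k * (e *ₚ prevColumn ƛ k) n ≃ fromNat k * (prevColumn ƛ k n + column ƛ k n)
  prev zero    = ≃-trans (*-zeroˡ ((e *ₚ prevColumn ƛ 0) n)) (≃-sym (*-zeroˡ (prevColumn ƛ 0 n + column ƛ 0 n)))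
  prev (suc k) = *-congˡ-≃ (degExp-column ƛ n k)

fubini : ℝ → ℕ → ℝ → ℝ
fubini ƛ n x = ∑< (suc n) (λ k → stirling ƛ n k * (fromNat (k !) * x ^ k))

-- The free bound `N` lets all coefficients up to `N` be written as sums of one common length, so
-- that the double sum in a convolution becomes rectangular and can be interchanged.
egf-fubini : ∀ ƛ x {n N} → n ℕ.≤ N →
  egf (λ n → fubini ƛ n x) n ≃ ∑< (suc N) (λ k → column ƛ k n * x ^ k)
egf-fubini ƛ x {n} {N} n≤N = begin
  fubini ƛ n x * invFact n
    ≈⟨ ∑<-*ʳ (suc n) (invFact n) (λ k → stirling ƛ n k * (fromNat (k !) * x ^ k)) ⟩
  ∑< (suc n) (λ k → stirling ƛ n k * (fromNat (k !) * x ^ k) * invFact n)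
    ≈⟨ ∑<-cong (suc n) (λ k _ → solve 4 (λ t f x r → t :* (f :* x) :* r := t :* f :* r :* x) ≃-refl
         (stirling ƛ n k) (fromNat (k !)) (x ^ k) (invFact n)) ⟩
  ∑< (suc n) (λ k → column ƛ k n * x ^ k)
    ≈⟨ ∑<-truncate {suc n} {suc N} {λ k → column ƛ k n * x ^ k} (s≤s n≤N) (λ k n<k →
         ≃-trans (*-congʳ-≃ (*-congʳ-≃ (*-congʳ-≃ (stirling-vanish ƛ n<k))))
           (solve 3 (λ f r x → con 0ℚ :* f :* r :* x := con 0ℚ) ≃-refl (fromNat (k !)) (invFact n) (x ^ k))) ⟨
  ∑< (suc N) (λ k → column ƛ k n * x ^ k) ∎

column-0 : ∀ ƛ n → column ƛ 0 n ≃ 1ₚ n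
column-0 ƛ zero    = pointwise-≃ λ _ → refl
column-0 ƛ (suc n) = ≃-trans (*-congʳ-≃ (*-congʳ-≃ (stirling-zero ƛ (suc n))))
  (solve 2 (λ f r → con 0ℚ :* f :* r := con 0ℚ) ≃-refl (fromNat 1) (invFact (suc n)))

-- Here `h = Σ Cₖ xᵏ`, and multiplication by `e` turns `Cₖ` into `Cₖ + Cₖ₊₁`. After the factor `x`,
-- the second half is `h` without its term `C₀ = 1`.
x*degExp*fubini : ∀ ƛ x n → let h = egf (λ n → fubini ƛ n x) in
  x * (degExp ƛ *ₚ h) n ≃ x * h n + h n - 1ₚ n
x*degExp*fubini ƛ x n = begin
  x * ∑< (suc n) (λ j → e j * h (n ∸ j))
    ≈⟨ *-congˡ-≃ (∑<-cong (suc n) λ j _ → begin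
        e j * h (n ∸ j)
          ≈⟨ *-congˡ-≃ (egf-fubini ƛ x (ℕ.m∸n≤m n j)) ⟩
        e j * ∑< (suc n) (λ k → column ƛ k (n ∸ j) * x ^ k)
          ≈⟨ ∑<-*ˡ (suc n) (e j) (λ k → column ƛ k (n ∸ j) * x ^ k) ⟩
        ∑< (suc n) (λ k → e j * (column ƛ k (n ∸ j) * x ^ k)) ∎) ⟩
  x * ∑< (suc n) (λ j → ∑< (suc n) (λ k → e j * (column ƛ k (n ∸ j) * x ^ k)))
    ≈⟨ *-congˡ-≃ (∑<-comm (suc n) (suc n) (λ j k → e j * (column ƛ k (n ∸ j) * x ^ k))) ⟩
  x * ∑< (suc n) (λ k → ∑< (suc n) (λ j → e j * (column ƛ k (n ∸ j) * x ^ k)))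
    ≈⟨ *-congˡ-≃ (∑<-cong (suc n) λ k _ → begin
        ∑< (suc n) (λ j → e j * (column ƛ k (n ∸ j) * x ^ k))
          ≈⟨ ∑<-cong (suc n) (λ j _ → solve 3 (λ a b c → a :* (b :* c) := a :* b :* c) ≃-refl
               (e j) (column ƛ k (n ∸ j)) (x ^ k)) ⟩
        ∑< (suc n) (λ j → e j * column ƛ k (n ∸ j) * x ^ k)
          ≈⟨ ∑<-*ʳ (suc n) (x ^ k) (λ j → e j * column ƛ k (n ∸ j)) ⟨
        (e *ₚ column ƛ k) n * x ^ k
          ≈⟨ *-congʳ-≃ (degExp-column ƛ n k) ⟩
        (column ƛ k n + column ƛ (suc k) n) * x ^ k ∎) ⟩
  x * ∑< (suc n) (λ k → (column ƛ k n + column ƛ (suc k) n) * x ^ k)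
    ≈⟨ ∑<-*ˡ (suc n) x (λ k → (column ƛ k n + column ƛ (suc k) n) * x ^ k) ⟩
  ∑< (suc n) (λ k → x * ((column ƛ k n + column ƛ (suc k) n) * x ^ k))
    ≈⟨ ∑<-cong (suc n) (λ k _ → solve 4 (λ x a b p → x :* ((a :+ b) :* p) := x :* (a :* p) :+ b :* (x :* p)) ≃-refl
         x (column ƛ k n) (column ƛ (suc k) n) (x ^ k)) ⟩
  ∑< (suc n) (λ k → x * (column ƛ k n * x ^ k) + column ƛ (suc k) n * x ^ suc k)
    ≈⟨ ∑<-+ (suc n) (λ k → x * (column ƛ k n * x ^ k)) (λ k → column ƛ (suc k) n * x ^ suc k) ⟩
  ∑< (suc n) (λ k → x * (column ƛ k n * x ^ k)) + tail
    ≈⟨ +-congʳ-≃ (∑<-*ˡ (suc n) x (λ k → column ƛ k n * x ^ k)) ⟨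
  x * ∑< (suc n) (λ k → column ƛ k n * x ^ k) + tail
    ≈⟨ solve 3 (λ a t c → a :+ t := a :+ (c :* con 1ℚ :+ t) :- c) ≃-refl
         (x * ∑< (suc n) (λ k → column ƛ k n * x ^ k)) tail (column ƛ 0 n) ⟩
  x * ∑< (suc n) (λ k → column ƛ k n * x ^ k) + (column ƛ 0 n * 1ℝ + tail) - column ƛ 0 n
    ≈⟨ +-cong-≃
        -- The first `h` is expanded up to `k = n`, the second up to `k = n + 1`, the length of the
        -- shifted `tail` together with its restored initial term.
        (+-cong-≃ (*-congˡ-≃ (egf-fubini ƛ x {n} ℕ.≤-refl)) (egf-fubini ƛ x (ℕ.n≤1+n n)))
        (-‿cong-≃ (≃-sym (column-0 ƛ n))) ⟨
  x * h n + h n - 1ₚ n ∎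
  where
  e h : PowerSeries
  e = degExp ƛ
  h = egf (λ n → fubini ƛ n x)
  tail : ℝ
  tail = ∑< (suc n) (λ k → column ƛ (suc k) n * x ^ suc k)

isDegFubini-fubini : ∀ ƛ x n →
  ((1ₚ -ₚ x ·ₚ (degExp ƛ -ₚ 1ₚ)) *ₚ egf (λ n → fubini ƛ n x)) n ≃ 1ₚ n
isDegFubini-fubini ƛ x n = begin
  ∑< (suc n) (λ j → (1ₚ j - x * (e j - 1ₚ j)) * h (n ∸ j))
    ≈⟨ ∑<-cong (suc n) (λ j _ → solve 4 (λ o x e h →
         (o :- x :* (e :- o)) :* h := (con 1ℚ :+ x) :* (o :* h) :+ (:- x) :* (e :* h)) ≃-refl
         (1ₚ j) x (e j) (h (n ∸ j))) ⟩
  ∑< (suc n) (λ j → (1ℝ + x) * (1ₚ j * h (n ∸ j)) + (- x) * (e j * h (n ∸ j)))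
    ≈⟨ ∑<-+ (suc n) (λ j → (1ℝ + x) * (1ₚ j * h (n ∸ j))) (λ j → (- x) * (e j * h (n ∸ j))) ⟩
  ∑< (suc n) (λ j → (1ℝ + x) * (1ₚ j * h (n ∸ j))) + ∑< (suc n) (λ j → (- x) * (e j * h (n ∸ j)))
    ≈⟨ +-cong-≃ (∑<-*ˡ (suc n) (1ℝ + x) (λ j → 1ₚ j * h (n ∸ j))) (∑<-*ˡ (suc n) (- x) (λ j → e j * h (n ∸ j))) ⟨
  (1ℝ + x) * (1ₚ *ₚ h) n + (- x) * (e *ₚ h) n
    ≈⟨ +-cong-≃ (*-congˡ-≃ (1ₚ-identityˡ h n))
         (solve 2 (λ x a → (:- x) :* a := :- (x :* a)) ≃-refl x ((e *ₚ h) n)) ⟩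
  (1ℝ + x) * h n - x * (e *ₚ h) n
    ≈⟨ +-congˡ-≃ (-‿cong-≃ (x*degExp*fubini ƛ x n)) ⟩
  (1ℝ + x) * h n - (x * h n + h n - 1ₚ n)
    ≈⟨ solve 3 (λ x h o → (con 1ℚ :+ x) :* h :- (x :* h :+ h :- o) := o) ≃-refl x (h n) (1ₚ n) ⟩
  1ₚ n ∎
  where
  e h : PowerSeries
  e = degExp ƛ
  h = egf (λ n → fubini ƛ n x)

degFubini-unique : ∀ ƛ F → IsDegFubini ƛ F → ∀ n x → F n x ≃ fubini ƛ n x
degFubini-unique ƛ F isF n x = egf-injective (λ n → F n x) (λ n → fubini ƛ n x) n
  (*ₚ-cancelˡ d (egf (λ n → F n x)) (egf (λ n → fubini ƛ n x)) d0≃1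
    (λ m → ≃-trans ⟪ isF x m ⟫ (≃-sym (isDegFubini-fubini ƛ x m))) n)
  where
  d : PowerSeries
  d = 1ₚ -ₚ x ·ₚ (degExp ƛ -ₚ 1ₚ)
  d0≃1 : d 0 ≃ 1ℝ
  d0≃1 = solve 1 (λ x → con 1ℚ :- x :* (con 1ℚ :* con 1ℚ :- con 1ℚ) := con 1ℚ) ≃-refl x

-- The first identity for the explicit families

∑₁-stirling : ∀ ƛ n → .{{_ : NonZero n}} → (w : ℕ → ℝ) →
  ∑[ 1 ⋯ n ] (λ k → stirling ƛ n k * w k) ≃ ∑< (suc n) (λ k → stirling ƛ n k * w k)
∑₁-stirling ƛ n w = ≃-sym (begin
  stirling ƛ n 0 * w 0 + rest ≈⟨ +-congʳ-≃ (*-congʳ-≃ (stirling-zero ƛ n)) ⟩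
  0ℝ * w 0 + rest             ≈⟨ solve 2 (λ w s → con 0ℚ :* w :+ s := s) ≃-refl (w 0) rest ⟩
  rest                        ∎)
  where
  rest : ℝ
  rest = ∑[ 1 ⋯ n ] (λ k → stirling ƛ n k * w k)

[1+x]*fubini : ∀ ƛ n → .{{_ : NonZero n}} → ∀ x →
  let w : ℕ → ℝ ; w k = fromNat ((k ∸ 1) !) * x ^ k in
  (1ℝ + x) * fubini ƛ n x
  ≃ ∑[ 1 ⋯ suc n ] (λ k → stirling ƛ (suc n) k * w k)
    + fromNat n * ƛ * ∑[ 1 ⋯ n ] (λ k → stirling ƛ n k * w k)
[1+x]*fubini ƛ n x = ≃-sym (begin
  ∑[ 1 ⋯ suc n ] (λ k → stirling ƛ (suc n) k * w k) + m * ∑[ 1 ⋯ n ] (λ k → T k * w k)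
    ≈⟨ +-cong-≃ (∑₁-stirling ƛ (suc n) w) (*-congˡ-≃ (∑₁-stirling ƛ n w)) ⟩
  ∑< (suc (suc n)) (λ k → stirling ƛ (suc n) k * w k) + m * ∑< (suc n) (λ k → T k * w k)
    ≈⟨ +-cong-≃ (∑-stirling-suc ƛ n w) (∑<-*ˡ (suc n) m (λ k → T k * w k)) ⟩
  ∑< (suc n) (λ k → T k * w (suc k) + (fromNat k - m) * (T k * w k)) + ∑< (suc n) (λ k → m * (T k * w k))
    ≈⟨ ∑<-+ (suc n) (λ k → T k * w (suc k) + (fromNat k - m) * (T k * w k)) (λ k → m * (T k * w k)) ⟨
  ∑< (suc n) (λ k → T k * w (suc k) + (fromNat k - m) * (T k * w k) + m * (T k * w k))
    ≈⟨ ∑<-cong (suc n) (λ k _ → begin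
        T k * w (suc k) + (fromNat k - m) * (T k * w k) + m * (T k * w k)
          -- The second sum of the identity cancels the `- nƛ` of the recurrence, leaving the plain
          -- factor `k`, which completes `(k - 1)!` to `k!`.
          ≈⟨ solve 5 (λ a k m t w → a :+ (k :- m) :* (t :* w) :+ m :* (t :* w) := a :+ t :* (k :* w)) ≃-refl
               (T k * w (suc k)) (fromNat k) m (T k) (w k) ⟩
        T k * w (suc k) + T k * (fromNat k * w k)
          ≈⟨ +-congˡ-≃ (k*w k) ⟩
        T k * (fromNat (k !) * (x * x ^ k)) + T k * (fromNat (k !) * x ^ k)
          ≈⟨ solve 4 (λ t f x p → t :* (f :* (x :* p)) :+ t :* (f :* p) := (con 1ℚ :+ x) :* (t :* (f :* p))) ≃-refl
               (T k) (fromNat (k !)) x (x ^ k) ⟩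
        (1ℝ + x) * (T k * (fromNat (k !) * x ^ k)) ∎) ⟩
  ∑< (suc n) (λ k → (1ℝ + x) * (T k * (fromNat (k !) * x ^ k)))
    ≈⟨ ∑<-*ˡ (suc n) (1ℝ + x) (λ k → T k * (fromNat (k !) * x ^ k)) ⟨
  (1ℝ + x) * fubini ƛ n x ∎)
  where
  w T : ℕ → ℝ
  w k = fromNat ((k ∸ 1) !) * x ^ k
  T = stirling ƛ n
  m : ℝ
  m = fromNat n * ƛ
  -- At `k = 0` the weights themselves disagree (`0` against `0! = 1`), hence the factor `T k`,
  -- which vanishes there because `n` is positive.
  k*w : ∀ k → T k * (fromNat k * w k) ≃ T k * (fromNat (k !) * x ^ k)
  k*w zero = ≃-trans (*-congʳ-≃ (stirling-zero ƛ n)) (≃-trans (*-zeroˡ (fromNat 0 * w 0))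
    (≃-sym (≃-trans (*-congʳ-≃ (stirling-zero ƛ n)) (*-zeroˡ (fromNat 1 * 1ℝ)))))
  k*w (suc k) = *-congˡ-≃ (begin
    fromNat (suc k) * (fromNat (k !) * x ^ suc k)
      ≈⟨ solve 3 (λ a b c → a :* (b :* c) := a :* b :* c) ≃-refl (fromNat (suc k)) (fromNat (k !)) (x ^ suc k) ⟩
    fromNat (suc k) * fromNat (k !) * x ^ suc k
      ≈⟨ *-congʳ-≃ (fromNat-* (suc k) (k !)) ⟨
    fromNat (suc k !) * x ^ suc k ∎)

-- Monomials

^-cong : ∀ {x y} k → x ≃ y → x ^ k ≃ y ^ k
^-cong zero    e = ≃-refl
^-cong (suc k) e = *-cong-≃ e (^-cong k e)

∣x^k∣≲ : ∀ {x b} k → ∣ x ∣ ≲ b → ∣ x ^ k ∣ ≲ b ^ k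
∣x^k∣≲ zero    p = ≲-reflexive (0≲x⇒∣x∣≃x (<⇒≲ (0<fromℚ (ℚ.positive⁻¹ 1ℚ))))
∣x^k∣≲ (suc k) p = ∣x*y∣≲ p (∣x^k∣≲ k p)

0≲x^k : ∀ {x} k → 0ℝ ≲ x → 0ℝ ≲ x ^ k
0≲x^k zero    p = <⇒≲ (0<fromℚ (ℚ.positive⁻¹ 1ℚ))
0≲x^k (suc k) p = 0≲x*y p (0≲x^k k p)

-- The product rule for differences; the recursion for `L` solves to `k Bᵏ⁻¹`.
^-lipschitz : ∀ {B} → 0ℝ ≲ B → ∀ k → ∃ λ L → 0ℝ ≲ L ×
  (∀ {u v} → ∣ u ∣ ≲ B → ∣ v ∣ ≲ B → ∣ v ^ k - u ^ k ∣ ≲ L * ∣ v - u ∣)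
^-lipschitz 0≲B zero = 0ℝ , ≲-refl , λ {u} {v} _ _ →
  x≃0⇒∣x∣≲ (solve 0 (con 1ℚ :- con 1ℚ := con 0ℚ) ≃-refl) (0≲x*y ≲-refl (0≲∣x∣ (v - u)))
^-lipschitz {B} 0≲B (suc k) =
  let L , 0≲L , lip = ^-lipschitz 0≲B k
  in B * L + B ^ k , 0≲x+y (0≲x*y 0≲B 0≲L) (0≲x^k k 0≲B) , λ {u} {v} ∣u∣≲B ∣v∣≲B →
    ≲-respˡ
      (∣∣-cong (solve 4 (λ u v u′ v′ → v :* (v′ :- u′) :+ u′ :* (v :- u) := v :* v′ :- u :* u′) ≃-refl
        u v (u ^ k) (v ^ k)))
      (≲-respʳ
        (solve 4 (λ b l p w → b :* (l :* w) :+ p :* w := (b :* l :+ p) :* w) ≃-refl B L (B ^ k) ∣ v - u ∣)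
        (∣x+y∣≲ (∣x*y∣≲ ∣v∣≲B (lip ∣u∣≲B ∣v∣≲B)) (∣x*y∣≲ (∣x^k∣≲ k ∣u∣≲B) ≲-refl)))

-- A form of `Φ′ = f` on `[- B , B]`, uniform and with the argument of `f` anywhere between `u` and
-- `v`. It is the error of a single Riemann summand; with mesh δ, the factor `(v - u) * (v - u)` is
-- at most `(v - u) * δ`.
IsPrimitive : ℝ → (f Φ : ℝ → ℝ) → Set
IsPrimitive B f Φ = ∃ λ M → 0ℝ ≲ M ×
  (∀ {u t v} → ∣ u ∣ ≲ B → ∣ t ∣ ≲ B → ∣ v ∣ ≲ B → u ≲ t → t ≲ v →
    ∣ f t * (v - u) - (Φ v - Φ u) ∣ ≲ M * ((v - u) * (v - u)))

-- Raising the exponent multiplies the previous error by `v` and adds two corrections,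
-- `(tᵏ⁺¹ - uᵏ⁺¹)(v - u)` and `- (k + 1) tᵏ (v - t)(v - u)`. Both are quadratic in the width, by the
-- Lipschitz bound and by `v - t ≲ v - u`; the three summands of the new constant bound these three
-- parts.
^-isPrimitive : ∀ {B} → 0ℝ ≲ B → ∀ k →
  IsPrimitive B (λ t → fromNat (suc k) * t ^ k) (λ t → t ^ suc k)
^-isPrimitive 0≲B zero = 0ℝ , ≲-refl , λ {u} {t} {v} _ _ _ _ _ →
  x≃0⇒∣x∣≲
    (solve 2 (λ u v → con 1ℚ :* con 1ℚ :* (v :- u) :- (v :* con 1ℚ :- u :* con 1ℚ) := con 0ℚ) ≃-refl u v)
    (≲-reflexive (≃-sym (*-zeroˡ ((v - u) * (v - u)))))
^-isPrimitive {B} 0≲B (suc k) =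
  let M , 0≲M , err = ^-isPrimitive 0≲B k
      L , 0≲L , lip = ^-lipschitz 0≲B (suc k)
      0≲KBᵏ = 0≲x*y (0≲fromNat (suc k)) (0≲x^k k 0≲B)
  in B * M + L + K * B ^ k , 0≲x+y (0≲x+y (0≲x*y 0≲B 0≲M) 0≲L) 0≲KBᵏ ,
  λ {u} {t} {v} ∣u∣≲B ∣t∣≲B ∣v∣≲B u≲t t≲v →
    let w       = v - u
        t-u≲w   = ≲-by {t} {v} {t - u} {v - u}
                    (solve 3 (λ u t v → v :- t := v :- u :- (t :- u)) ≃-refl u t v) t≲v
        v-t≲w   = ≲-by {u} {t} {v - t} {v - u}
                    (solve 3 (λ u t v → t :- u := v :- u :- (v :- t)) ≃-refl u t v) u≲t
        ∣t-u∣≲w = ≲-respˡ (≃-sym (0≲x⇒∣x∣≃x (x≲y⇒0≲y-x u≲t))) t-u≲w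
        ∣v-t∣≲w = ≲-respˡ (≃-sym (0≲x⇒∣x∣≃x (x≲y⇒0≲y-x t≲v))) v-t≲w
        ∣w∣≲w   = ≲-reflexive (0≲x⇒∣x∣≃x (x≲y⇒0≲y-x (≲-trans u≲t t≲v)))
    in ≲-respˡ
      (∣∣-cong (≃-trans
        (solve 7 (λ u t v u′ t′ v′ k →
          v :* (k :* t′ :* (v :- u) :- (v :* v′ :- u :* u′)) :+ (t :* t′ :- u :* u′) :* (v :- u)
            :+ k :* t′ :* (:- (v :- t) :* (v :- u))
          := (con 1ℚ :+ k) :* (t :* t′) :* (v :- u) :- (v :* (v :* v′) :- u :* (u :* u′))) ≃-refl
          u t v (u ^ k) (t ^ k) (v ^ k) K)
        (+-congʳ-≃ (*-congʳ-≃ (*-congʳ-≃ (≃-sym (fromNat-suc (suc k))))))))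
      (≲-respʳ
        (solve 6 (λ b m l k p w → b :* (m :* (w :* w)) :+ l :* w :* w :+ k :* p :* (w :* w)
          := (b :* m :+ l :+ k :* p) :* (w :* w)) ≃-refl B M L K (B ^ k) w)
        (∣x+y∣≲
          (∣x+y∣≲
            (∣x*y∣≲ ∣v∣≲B (err ∣u∣≲B ∣t∣≲B ∣v∣≲B u≲t t≲v))
            (∣x*y∣≲ (≲-trans (lip ∣u∣≲B ∣t∣≲B) (*-monoˡ-≲ 0≲L ∣t-u∣≲w)) ∣w∣≲w))
          (∣x*y∣≲
            (∣x*y∣≲ (≲-reflexive (0≲x⇒∣x∣≃x (0≲fromNat (suc k)))) (∣x^k∣≲ k ∣t∣≲B))
            (∣x*y∣≲ (≲-respˡ (≃-sym (∣-x∣≃∣x∣ (v - t))) ∣v-t∣≲w) ∣w∣≲w))))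
  where
  K : ℝ
  K = fromNat (suc k)

*-isPrimitive : ∀ {B f Φ} c → IsPrimitive B f Φ → IsPrimitive B (λ t → c * f t) (λ t → c * Φ t)
*-isPrimitive {f = f} {Φ} c (M , 0≲M , err) = ∣ c ∣ * M , 0≲x*y (0≲∣x∣ c) 0≲M ,
  λ {u} {t} {v} ∣u∣≲B ∣t∣≲B ∣v∣≲B u≲t t≲v → ≲-respˡ
    (∣∣-cong (solve 5 (λ c f w a b → c :* (f :* w :- (a :- b)) := c :* f :* w :- (c :* a :- c :* b)) ≃-refl
      c (f t) (v - u) (Φ v) (Φ u)))
    (≲-respʳ
      (solve 3 (λ c m w → c :* (m :* w) := c :* m :* w) ≃-refl ∣ c ∣ M ((v - u) * (v - u)))
      (∣x*y∣≲ {c} ≲-refl (err ∣u∣≲B ∣t∣≲B ∣v∣≲B u≲t t≲v)))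

∑<-isPrimitive : ∀ {B} n (f Φ : ℕ → ℝ → ℝ) → (∀ k → IsPrimitive B (f k) (Φ k)) →
  IsPrimitive B (λ t → ∑< n (λ k → f k t)) (λ t → ∑< n (λ k → Φ k t))
∑<-isPrimitive zero f Φ prim = 0ℝ , ≲-refl , λ {u} {t} {v} _ _ _ _ _ →
  x≃0⇒∣x∣≲
    (solve 1 (λ w → con 0ℚ :* w :- (con 0ℚ :- con 0ℚ) := con 0ℚ) ≃-refl (v - u))
    (≲-reflexive (≃-sym (*-zeroˡ ((v - u) * (v - u)))))
∑<-isPrimitive (suc n) f Φ prim =
  let M , 0≲M , err = prim 0
      N , 0≲N , errs = ∑<-isPrimitive n (λ k → f (suc k)) (λ k → Φ (suc k)) (λ k → prim (suc k))
  in M + N , 0≲x+y 0≲M 0≲N , λ {u} {t} {v} ∣u∣≲B ∣t∣≲B ∣v∣≲B u≲t t≲v → ≲-respˡ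
    (∣∣-cong (solve 7 (λ f s w a b c d →
      (f :* w :- (a :- b)) :+ (s :* w :- (c :- d)) := (f :+ s) :* w :- ((a :+ c) :- (b :+ d))) ≃-refl
      (f 0 t) (∑< n (λ k → f (suc k) t)) (v - u) (Φ 0 v) (Φ 0 u)
      (∑< n (λ k → Φ (suc k) v)) (∑< n (λ k → Φ (suc k) u))))
    (≲-respʳ
      (solve 3 (λ m n w → m :* w :+ n :* w := (m :+ n) :* w) ≃-refl M N ((v - u) * (v - u)))
      (∣x+y∣≲ (err ∣u∣≲B ∣t∣≲B ∣v∣≲B u≲t t≲v) (errs ∣u∣≲B ∣t∣≲B ∣v∣≲B u≲t t≲v)))

-- Twice the truncation of y to [-δ , δ].
clamp : ℝ → ℝ → ℝ
clamp δ y = ∣ y + δ ∣ - ∣ y - δ ∣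

clamp≲ : ∀ {δ} → 0ℝ ≲ δ → ∀ y → clamp δ y ≲ δ + δ
clamp≲ {δ} 0≲δ y = ≲-by
  (≃-trans
    (+-cong-≃ (+-congˡ-≃ (0≲x⇒∣x∣≃x (0≲x+y 0≲δ 0≲δ)))
      (-‿cong-≃ (∣∣-cong (solve 2 (λ y d → y :- d :+ (d :+ d) := y :+ d) ≃-refl y δ))))
    (solve 3 (λ a b d → b :+ d :- a := d :- (a :- b)) ≃-refl ∣ y + δ ∣ ∣ y - δ ∣ (δ + δ)))
  (∣x+y∣≲∣x∣+∣y∣ (y - δ) (δ + δ))

≲clamp : ∀ {δ} → 0ℝ ≲ δ → ∀ y → - (δ + δ) ≲ clamp δ y
≲clamp {δ} 0≲δ y = ≲-by
  (≃-trans
    (+-cong-≃ (+-congˡ-≃ (≃-trans (∣-x∣≃∣x∣ (δ + δ)) (0≲x⇒∣x∣≃x (0≲x+y 0≲δ 0≲δ))))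
      (-‿cong-≃ (∣∣-cong (solve 2 (λ y d → y :+ d :- (d :+ d) := y :- d) ≃-refl y δ))))
    (solve 3 (λ a b d → a :+ d :- b := (a :- b) :- :- d) ≃-refl ∣ y + δ ∣ ∣ y - δ ∣ (δ + δ)))
  (∣x+y∣≲∣x∣+∣y∣ (y + δ) (- (δ + δ)))

-- If `y + δ` is nonnegative, so is `z + δ`, and the claim is the triangle inequality for
-- `z - δ = (z - y) + (y - δ)`. Otherwise `clamp δ y` has its least value `- (δ + δ)`.
clamp-mono : ∀ {δ y z} → 0ℝ ≲ δ → y ≲ z → clamp δ y ≲ clamp δ z
clamp-mono {δ} {y} {z} 0≲δ y≲z = ≲-by-cases 0ℝ (y + δ)
  (λ 0≲y+δ → ≲-by
    (begin
      ∣ z - y ∣ + ∣ y - δ ∣ - ∣ z - y + (y - δ) ∣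
        ≈⟨ +-cong-≃ (+-congʳ-≃ (0≲x⇒∣x∣≃x (x≲y⇒0≲y-x y≲z)))
             (-‿cong-≃ (∣∣-cong (solve 3 (λ y z d → z :- y :+ (y :- d) := z :- d) ≃-refl y z δ))) ⟩
      z - y + ∣ y - δ ∣ - ∣ z - δ ∣
        ≈⟨ solve 5 (λ y z d a b → z :- y :+ a :- b := (z :+ d :- b) :- (y :+ d :- a)) ≃-refl
             y z δ ∣ y - δ ∣ ∣ z - δ ∣ ⟩
      (z + δ - ∣ z - δ ∣) - (y + δ - ∣ y - δ ∣)
        ≈⟨ +-cong-≃ (+-congʳ-≃ (0≲x⇒∣x∣≃x (≲-trans 0≲y+δ (+-mono-≲ y≲z ≲-refl))))
             (-‿cong-≃ (+-congʳ-≃ (0≲x⇒∣x∣≃x 0≲y+δ))) ⟨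
      clamp δ z - clamp δ y ∎)
    (∣x+y∣≲∣x∣+∣y∣ (z - y) (y - δ)))
  (λ y+δ≲0 → ≲-respˡ
    (begin
      - (δ + δ)               ≈⟨ solve 2 (λ y d → :- (d :+ d) := :- (y :+ d) :- :- (y :- d)) ≃-refl y δ ⟩
      - (y + δ) - - (y - δ)   ≈⟨ +-cong-≃ (x≲0⇒∣x∣≃-x y+δ≲0) (-‿cong-≃ (x≲0⇒∣x∣≃-x
                                   (≲-by (solve 2 (λ y d → con 0ℚ :+ (d :+ d) :- (y :+ d :+ con 0ℚ)
                                     := con 0ℚ :- (y :- d)) ≃-refl y δ)
                                     (+-mono-≲ y+δ≲0 (0≲x+y 0≲δ 0≲δ))))) ⟨
      clamp δ y               ∎)
    (≲clamp 0≲δ z))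

clamp-inside : ∀ {δ y} → - δ ≲ y → y ≲ δ → clamp δ y ≃ y + y
clamp-inside {δ} {y} -δ≲y y≲δ = begin
  ∣ y + δ ∣ - ∣ y - δ ∣
    ≈⟨ +-cong-≃
         (0≲x⇒∣x∣≃x (≲-by (solve 2 (λ y d → y :- :- d := y :+ d :- con 0ℚ) ≃-refl y δ) -δ≲y))
         (-‿cong-≃ (x≲0⇒∣x∣≃-x (≲-by (solve 2 (λ y d → d :- y := con 0ℚ :- (y :- d)) ≃-refl y δ) y≲δ))) ⟩
  y + δ - - (y - δ)
    ≈⟨ solve 2 (λ y d → y :+ d :- :- (y :- d) := y :+ y) ≃-refl y δ ⟩
  y + y ∎

-- Such an interval lies within `[- δ , δ]`, where `clamp δ` is doubling, so the increment is even
-- twice the width.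
width≲clamp : ∀ {δ u v} → u ≲ 0ℝ → 0ℝ ≲ v → v - u ≲ δ → v - u ≲ clamp δ v - clamp δ u
width≲clamp {δ} {u} {v} u≲0 0≲v v-u≲δ = ≲-respʳ
  (≃-trans (solve 2 (λ u v → v :- u :+ (v :- u) := v :+ v :- (u :+ u)) ≃-refl u v)
    (+-cong-≃ (≃-sym (clamp-inside -δ≲v v≲δ)) (-‿cong-≃ (≃-sym (clamp-inside -δ≲u u≲δ)))))
  (≲-respˡ (+-identityʳ (v - u)) (+-mono-≲ ≲-refl 0≲w))
  where
  0≲w : 0ℝ ≲ v - u
  0≲w = x≲y⇒0≲y-x (≲-trans u≲0 0≲v)
  0≲δ : 0ℝ ≲ δ
  0≲δ = ≲-trans 0≲w v-u≲δ
  -δ≲0 : - δ ≲ 0ℝ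
  -δ≲0 = ≲-by (solve 1 (λ d → d :- con 0ℚ := con 0ℚ :- :- d) ≃-refl δ) 0≲δ
  -δ≲v : - δ ≲ v
  -δ≲v = ≲-trans -δ≲0 0≲v
  u≲δ : u ≲ δ
  u≲δ = ≲-trans u≲0 0≲δ
  v≲δ : v ≲ δ
  v≲δ = ≲-by (solve 3 (λ u v d → d :+ con 0ℚ :- (v :- u :+ u) := d :- v) ≃-refl u v δ) (+-mono-≲ v-u≲δ u≲0)
  -δ≲u : - δ ≲ u
  -δ≲u = ≲-by (solve 3 (λ u v d → d :+ v :- (v :- u :+ con 0ℚ) := u :- :- d) ≃-refl u v δ) (+-mono-≲ v-u≲δ 0≲v)

-- Riemann integrals

-- Local errors are bounded by increments of a function `q` instead of by numbers, so the bounds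
-- collapse along with the main terms and the number of subintervals never enters.
telescope : ∀ n (r : Fin n → ℝ) (p q : Fin (suc n) → ℝ) →
  (∀ i → ∣ r i - (p (fsuc i) - p (inject₁ i)) ∣ ≲ q (fsuc i) - q (inject₁ i)) →
  ∣ sum r - (p (fromℕ n) - p fzero) ∣ ≲ q (fromℕ n) - q fzero
telescope zero r p q le = x≃0⇒∣x∣≲
  (solve 1 (λ p → con 0ℚ :- (p :- p) := con 0ℚ) ≃-refl (p fzero))
  (≲-reflexive (solve 1 (λ q → con 0ℚ := q :- q) ≃-refl (q fzero)))
telescope (suc n) r p q le = ≲-respˡ
  (∣∣-cong (solve 5 (λ r s a b c → (r :- (b :- a)) :+ (s :- (c :- b)) := r :+ s :- (c :- a)) ≃-refl
    (r fzero) (sum (λ i → r (fsuc i))) (p fzero) (p (fsuc fzero)) (p (fromℕ (suc n)))))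
  (≲-respʳ
    (solve 3 (λ a b c → b :- a :+ (c :- b) := c :- a) ≃-refl (q fzero) (q (fsuc fzero)) (q (fromℕ (suc n))))
    (∣x+y∣≲ (le fzero)
      (telescope n (λ i → r (fsuc i)) (λ i → p (fsuc i)) (λ i → q (fsuc i)) (λ i → le (fsuc i)))))

≲-first : ∀ n (p : Fin (suc n) → ℝ) → (∀ i → p (inject₁ i) ≲ p (fsuc i)) → ∀ i → p fzero ≲ p i
≲-first n       p mono fzero    = ≲-refl
≲-first (suc n) p mono (fsuc i) =
  ≲-trans (mono fzero) (≲-first n (λ i → p (fsuc i)) (λ i → mono (fsuc i)) i)

≲-last : ∀ n (p : Fin (suc n) → ℝ) → (∀ i → p (inject₁ i) ≲ p (fsuc i)) → ∀ i → p i ≲ p (fromℕ n)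
≲-last zero    p mono fzero    = ≲-refl
≲-last (suc n) p mono fzero    =
  ≲-trans (mono fzero) (≲-last n (λ i → p (fsuc i)) (λ i → mono (fsuc i)) fzero)
≲-last (suc n) p mono (fsuc i) = ≲-last n (λ i → p (fsuc i)) (λ i → mono (fsuc i)) i

Congruent : (ℝ → ℝ) → Set
Congruent f = ∀ {s t} → s ≃ t → f s ≃ f t

-- At a tag t # 0 the values g t and f t agree.  If t ≃ 0, the subinterval
-- contains 0 and has width at most δ, so its width is at most the increment
-- of clamp δ; these increments sum to at most 4 δ.
exceptional-error : ∀ {f g δ u t v} → Congruent f → Congruent g → (∀ t → t # 0ℝ → g t ≃ f t) →
  0ℝ ≲ δ → u ≲ t → t ≲ v → v - u ≲ δ →
  ∣ (g t - f t) * (v - u) ∣ ≲ ∣ g 0ℝ - f 0ℝ ∣ * (clamp δ v - clamp δ u)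
exceptional-error {f} {g} {δ} {u} {t} {v} f-cong g-cong g≃f 0≲δ u≲t t≲v v-u≲δ =
  ≲-by-#-cases t 0ℝ
    (λ t#0 → x≃0⇒∣x∣≲
      (≃-trans (*-congʳ-≃ (+-congʳ-≃ (g≃f t t#0)))
        (solve 2 (λ f w → (f :- f) :* w := con 0ℚ) ≃-refl (f t) (v - u)))
      (0≲x*y (0≲∣x∣ (g 0ℝ - f 0ℝ)) (x≲y⇒0≲y-x (clamp-mono 0≲δ (≲-trans u≲t t≲v)))))
    (λ t≃0 → ∣x*y∣≲
      (≲-reflexive (∣∣-cong (+-cong-≃ (g-cong t≃0) (-‿cong-≃ (f-cong t≃0)))))
      (≲-respˡ (≃-sym (0≲x⇒∣x∣≃x (x≲y⇒0≲y-x (≲-trans u≲t t≲v))))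
        (width≲clamp (≲-respʳ t≃0 u≲t) (≲-respˡ t≃0 t≲v) v-u≲δ)))

-- A partition orders its own end points, so one statement serves both orientations of the integral
-- from `0` to `x`.
isRiemannIntegral : ∀ {f g Φ a b I} → Congruent f → Congruent g → Congruent Φ →
  (∀ t → t # 0ℝ → g t ≃ f t) → (∀ {B} → 0ℝ ≲ B → IsPrimitive B f Φ) →
  I ≃ Φ b - Φ a → IsRiemannIntegral g a b I
isRiemannIntegral {f} {g} {Φ} {a} {b} {I} f-cong g-cong Φ-cong g≃f prim I≃ ε 0<ε =
  -- Every point and tag lies between `a` and `b`, hence has absolute value at most `∣ a ∣ + ∣ b ∣`.
  -- In the next line, `M * (b - a)` pays for the quadratic errors and `four * D` for the value at
  -- `0`.
  let M , 0≲M , err = prim {∣ a ∣ + ∣ b ∣} (0≲x+y (0≲∣x∣ a) (0≲∣x∣ b))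
      δ , 0<δ , Kδ≲ε = small-multiple (M * (b - a) + four * D) ε 0<ε
  in δ , 0<δ , λ P mesh → unwrap-≤ (≲-trans (estimate M 0≲M err δ (<⇒≲ 0<δ) P mesh) Kδ≲ε)
  where
  D four : ℝ
  D    = ∣ g 0ℝ - f 0ℝ ∣
  four = (1ℝ + 1ℝ) + (1ℝ + 1ℝ)
  estimate : ∀ M → 0ℝ ≲ M →
    (∀ {u t v} → ∣ u ∣ ≲ ∣ a ∣ + ∣ b ∣ → ∣ t ∣ ≲ ∣ a ∣ + ∣ b ∣ → ∣ v ∣ ≲ ∣ a ∣ + ∣ b ∣ → u ≲ t → t ≲ v →
      ∣ f t * (v - u) - (Φ v - Φ u) ∣ ≲ M * ((v - u) * (v - u))) →
    ∀ δ → 0ℝ ≲ δ → (P : TaggedPartition a b) → MeshAtMost δ P →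
    ∣ riemannSum g P - I ∣ ≲ (M * (b - a) + four * D) * δ
  estimate M 0≲M err δ 0≲δ P mesh = ≲-respˡ
    (∣∣-cong (+-congˡ-≃ (-‿cong-≃ (≃-trans
      (+-cong-≃ (Φ-cong ⟪ last P ⟫) (-‿cong-≃ (Φ-cong ⟪ first P ⟫))) (≃-sym I≃)))))
    (≲-trans
      (telescope (size P) (λ i → g (tag P i) * width P i) (λ i → Φ (p i)) (λ i → Ψ (p i)) local)
      total)
    where
    p : Fin (suc (size P)) → ℝ
    p = point P
    -- The function whose increments dominate the local errors: the linear part for `f` against its
    -- primitive, the `clamp` part for replacing `f` by `g` at the tag.
    Ψ : ℝ → ℝ
    Ψ y = M * δ * y + D * clamp δ y
    lo : ∀ i → p (inject₁ i) ≲ tag P i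
    lo i = ⟪ lower P i ⟫
    up : ∀ i → tag P i ≲ p (fsuc i)
    up i = ⟪ upper P i ⟫
    mono : ∀ i → p (inject₁ i) ≲ p (fsuc i)
    mono i = ≲-trans (lo i) (up i)
    a≲p : ∀ i → a ≲ p i
    a≲p i = ≲-respˡ ⟪ first P ⟫ (≲-first (size P) p mono i)
    p≲b : ∀ i → p i ≲ b
    p≲b i = ≲-respʳ ⟪ last P ⟫ (≲-last (size P) p mono i)
    local : ∀ i → ∣ g (tag P i) * width P i - (Φ (p (fsuc i)) - Φ (p (inject₁ i))) ∣
                  ≲ Ψ (p (fsuc i)) - Ψ (p (inject₁ i))
    local i = ≲-respˡ
      (∣∣-cong (solve 5 (λ f g w a b → (f :* w :- (a :- b)) :+ (g :- f) :* w := g :* w :- (a :- b)) ≃-refl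
        (f t) (g t) (v - u) (Φ v) (Φ u)))
      (≲-respʳ
        (solve 7 (λ m d D u v a b → m :* d :* (v :- u) :+ D :* (b :- a)
          := (m :* d :* v :+ D :* b) :- (m :* d :* u :+ D :* a)) ≃-refl M δ D u v (clamp δ u) (clamp δ v))
        (∣x+y∣≲
          (≲-trans
            (err (∣∣-between (a≲p (inject₁ i)) (p≲b (inject₁ i)))
                 (∣∣-between (≲-trans (a≲p (inject₁ i)) (lo i)) (≲-trans (up i) (p≲b (fsuc i))))
                 (∣∣-between (a≲p (fsuc i)) (p≲b (fsuc i))) (lo i) (up i))
            (≲-respʳ
              (solve 3 (λ m d w → m :* (w :* d) := m :* d :* w) ≃-refl M δ (v - u))
              (*-monoˡ-≲ 0≲M (*-monoˡ-≲ (x≲y⇒0≲y-x (mono i)) ⟪ mesh i ⟫))))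
          (exceptional-error f-cong g-cong g≃f 0≲δ (lo i) (up i) ⟪ mesh i ⟫)))
      where
      u t v : ℝ
      u = p (inject₁ i)
      t = tag P i
      v = p (fsuc i)
    total : Ψ (p (fromℕ (size P))) - Ψ (p fzero) ≲ (M * (b - a) + four * D) * δ
    total = ≲-respˡ
      (solve 7 (λ m d D u v a b → m :* d :* (v :- u) :+ D :* (b :+ :- a)
        := (m :* d :* v :+ D :* b) :- (m :* d :* u :+ D :* a)) ≃-refl M δ D u v (clamp δ u) (clamp δ v))
      (≲-respʳ
        (solve 5 (λ m d D a b → m :* d :* (b :- a) :+ D :* (d :+ d :+ (d :+ d))
          := (m :* (b :- a) :+ ((con 1ℚ :+ con 1ℚ) :+ (con 1ℚ :+ con 1ℚ)) :* D) :* d) ≃-refl M δ D a b)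
        (+-mono-≲
          (≲-reflexive (*-congˡ-≃ (+-cong-≃ ⟪ last P ⟫ (-‿cong-≃ ⟪ first P ⟫))))
          (*-monoˡ-≲ (0≲∣x∣ (g 0ℝ - f 0ℝ)) (+-mono-≲ (clamp≲ 0≲δ v)
            (≲-by (solve 2 (λ c d → c :- :- (d :+ d) := d :+ d :- :- c) ≃-refl (clamp δ u) δ)
              (≲clamp 0≲δ u))))))
      where
      u v : ℝ
      u = p fzero
      v = p (fromℕ (size P))

isIntegral-from-0 : ∀ {f g Φ x} → Congruent f → Congruent g → Congruent Φ →
  (∀ t → t # 0ℝ → g t ≃ f t) → (∀ {B} → 0ℝ ≲ B → IsPrimitive B f Φ) →
  Φ 0ℝ ≃ 0ℝ → IsIntegral g 0ℝ x (Φ x)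
isIntegral-from-0 {f} {g} {Φ} {x} f-cong g-cong Φ-cong g≃f prim Φ0≃0 =
  (λ _ → isRiemannIntegral {f} {g} {Φ} f-cong g-cong Φ-cong g≃f prim
    (≃-trans (solve 1 (λ a → a := a :- con 0ℚ) ≃-refl (Φ x)) (+-congˡ-≃ (-‿cong-≃ (≃-sym Φ0≃0))))) ,
  (λ _ → isRiemannIntegral {f} {g} {Φ} f-cong g-cong Φ-cong g≃f prim
    (≃-trans (≃-sym (+-identityˡ (- Φ x))) (+-congʳ-≃ (≃-sym Φ0≃0))))

-- Integrals of the Fubini polynomials divided by the variable

x*inverse : ∀ x x#0 → x * inverse x x#0 ≃ 1ℝ
x*inverse x x#0 = let c , 0<c , N , c≤∣x∣ = awayFrom0 x x#0 in
  -- As `recip` is `0` at `0`, the product of the sequences is known to be `1` only from the index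
  -- `N` on, where `x` is bounded away from `0`.
  ⟪ (λ ε 0<ε → N , λ n N≤n → subst (ℚ._< ε)
      (≡.sym (≡.trans
        (cong (λ z → ℚ.∣ z ℚ.- 1ℚ ∣) (recip-inverse (seq x n) (0<∣p∣⇒p≢0 (seq x n) 0<c (c≤∣x∣ n N≤n))))
        (∣p-p∣≡0 1ℚ)))
      0<ε) ⟫

-- The integral of F_n(t) / t from 0 to x.
logFubini : ℝ → ℕ → ℝ → ℝ
logFubini ƛ n x = ∑[ 1 ⋯ n ] (λ k → stirling ƛ n k * fromNat ((k ∸ 1) !) * x ^ k)

-- The factor `(k + 1)!` is split into `k!` and `k + 1` so that each summand is a constant times the
-- integrand of `^-isPrimitive`.
fubini/t : ℝ → ℕ → ℝ → ℝ
fubini/t ƛ n t = ∑< n (λ k → stirling ƛ n (suc k) * fromNat (k !) * (fromNat (suc k) * t ^ k))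

logFubini-isPrimitive : ∀ ƛ n {B} → 0ℝ ≲ B → IsPrimitive B (fubini/t ƛ n) (logFubini ƛ n)
logFubini-isPrimitive ƛ n 0≲B = ∑<-isPrimitive n
  (λ k t → stirling ƛ n (suc k) * fromNat (k !) * (fromNat (suc k) * t ^ k))
  (λ k t → stirling ƛ n (suc k) * fromNat (k !) * t ^ suc k)
  λ k → *-isPrimitive (stirling ƛ n (suc k) * fromNat (k !)) (^-isPrimitive 0≲B k)

logFubini-cong : ∀ ƛ n → Congruent (logFubini ƛ n)
logFubini-cong ƛ n s≃t = ∑<-cong n
  {λ k → stirling ƛ n (suc k) * fromNat (k !) * _ ^ suc k}
  {λ k → stirling ƛ n (suc k) * fromNat (k !) * _ ^ suc k}
  λ k _ → *-congˡ-≃ (^-cong (suc k) s≃t)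

fubini/t-cong : ∀ ƛ n → Congruent (fubini/t ƛ n)
fubini/t-cong ƛ n s≃t = ∑<-cong n
  {λ k → stirling ƛ n (suc k) * fromNat (k !) * (fromNat (suc k) * _ ^ k)}
  {λ k → stirling ƛ n (suc k) * fromNat (k !) * (fromNat (suc k) * _ ^ k)}
  λ k _ → *-congˡ-≃ (*-congˡ-≃ (^-cong k s≃t))

logFubini-0 : ∀ ƛ n → logFubini ƛ n 0ℝ ≃ 0ℝ
logFubini-0 ƛ n = ∑<-zero n λ k _ →
  solve 2 (λ c p → c :* (con 0ℚ :* p) := con 0ℚ) ≃-refl (stirling ƛ n (suc k) * fromNat (k !)) (0ℝ ^ k)

fubini≃t*fubini/t : ∀ ƛ n → .{{_ : NonZero n}} → ∀ t → fubini ƛ n t ≃ t * fubini/t ƛ n t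
fubini≃t*fubini/t ƛ n t = begin
  fubini ƛ n t
    ≈⟨ ∑₁-stirling ƛ n (λ k → fromNat (k !) * t ^ k) ⟨
  ∑< n (λ k → stirling ƛ n (suc k) * (fromNat (suc k !) * t ^ suc k))
    ≈⟨ ∑<-cong n (λ k _ → ≃-trans
         (*-congˡ-≃ (*-congʳ-≃ (fromNat-* (suc k) (k !))))
         (solve 5 (λ s m f t p → s :* (m :* f :* (t :* p)) := t :* (s :* f :* (m :* p))) ≃-refl
           (stirling ƛ n (suc k)) (fromNat (suc k)) (fromNat (k !)) t (t ^ k))) ⟩
  ∑< n (λ k → t * (stirling ƛ n (suc k) * fromNat (k !) * (fromNat (suc k) * t ^ k)))
    ≈⟨ ∑<-*ˡ n t (λ k → stirling ƛ n (suc k) * fromNat (k !) * (fromNat (suc k) * t ^ k)) ⟨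
  t * fubini/t ƛ n t ∎

∫degFubini/t : ∀ ƛ F g → IsDegFubini ƛ F → ∀ n → .{{_ : NonZero n}} →
  IsQuotientByVariable (F n) g → ∀ x → IsIntegral g 0ℝ x (logFubini ƛ n x)
∫degFubini/t ƛ F g isF n (g-cong , g-quot) x = isIntegral-from-0 {f = fubini/t ƛ n} {g} {logFubini ƛ n}
  (fubini/t-cong ƛ n) (λ {s} {t} s≃t → ⟪ g-cong s t (unwrap s≃t) ⟫) (logFubini-cong ƛ n)
  (λ t t#0 → begin
    g t
      ≈⟨ ⟪ g-quot t t#0 ⟫ ⟩
    F n t * inverse t t#0
      ≈⟨ *-congʳ-≃ (≃-trans (degFubini-unique ƛ F isF n t) (fubini≃t*fubini/t ƛ n t)) ⟩
    t * fubini/t ƛ n t * inverse t t#0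
      ≈⟨ solve 3 (λ t q r → t :* q :* r := t :* r :* q) ≃-refl t (fubini/t ƛ n t) (inverse t t#0) ⟩
    t * inverse t t#0 * fubini/t ƛ n t
      ≈⟨ *-congʳ-≃ (x*inverse t t#0) ⟩
    1ℝ * fubini/t ƛ n t
      ≈⟨ *-identityˡ (fubini/t ƛ n t) ⟩
    fubini/t ƛ n t ∎)
  (logFubini-isPrimitive ƛ n) (logFubini-0 ƛ n)

-- Both identities for arbitrary `S` and `F`

[1+x]*degFubini : ∀ ƛ F → IsDegFubini ƛ F → ∀ n → .{{_ : NonZero n}} → ∀ x →
  (1ℝ + x) * F n x ≃ logFubini ƛ (suc n) x + fromNat n * ƛ * logFubini ƛ n x
[1+x]*degFubini ƛ F isF n x = begin
  (1ℝ + x) * F n x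
    ≈⟨ *-congˡ-≃ (degFubini-unique ƛ F isF n x) ⟩
  (1ℝ + x) * fubini ƛ n x
    ≈⟨ [1+x]*fubini ƛ n x ⟩
  ∑< (suc n) (λ k → stirling ƛ (suc n) (suc k) * (fromNat (k !) * x ^ suc k))
    + fromNat n * ƛ * ∑< n (λ k → stirling ƛ n (suc k) * (fromNat (k !) * x ^ suc k))
    ≈⟨ +-cong-≃ (reassoc (suc n)) (*-congˡ-≃ (reassoc n)) ⟩
  logFubini ƛ (suc n) x + fromNat n * ƛ * logFubini ƛ n x ∎
  where
  reassoc : ∀ m → ∑< m (λ k → stirling ƛ m (suc k) * (fromNat (k !) * x ^ suc k)) ≃ logFubini ƛ m x
  reassoc m = ∑<-cong m λ k _ →
    solve 3 (λ a b c → a :* (b :* c) := a :* b :* c) ≃-refl (stirling ƛ m (suc k)) (fromNat (k !)) (x ^ suc k)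

logFubini-degStirling₂ : ∀ ƛ S → IsDegStirling₂ ƛ S → ∀ n x →
  logFubini ƛ n x ≃ ∑[ 1 ⋯ n ] (λ k → S n k * fromNat ((k ∸ 1) !) * x ^ k)
logFubini-degStirling₂ ƛ S isS n x = ∑<-cong n
  {λ k → stirling ƛ n (suc k) * fromNat (k !) * x ^ suc k}
  {λ k → S n (suc k) * fromNat (k !) * x ^ suc k}
  λ k k<n → *-congʳ-≃ (*-congʳ-≃ (≃-sym (degStirling₂-unique ƛ S isS n (suc k) k<n)))

theorem13 : (ƛ : ℝ) → ¬ (ƛ ≈ 0ℝ) → (n : ℕ) → .{{_ : NonZero n}} →
    (S : ℕ → ℕ → ℝ) → IsDegStirling₂ ƛ S →
    (F : ℕ → ℝ → ℝ) → IsDegFubini ƛ F →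
    (x : ℝ) →
    ((1ℝ + x) * F n x
    ≈ ∑[ 1 ⋯ suc n ] (λ k → S (suc n) k * fromNat ((k ∸ 1) !) * x ^ k)
    + fromNat n * ƛ * ∑[ 1 ⋯ n ] (λ k → S n k * fromNat ((k ∸ 1) !) * x ^ k))
    ×
    ((g h : ℝ → ℝ) →
    IsQuotientByVariable (F (suc n)) g → IsQuotientByVariable (F n) h →
    ∃₂ λ I J → IsIntegral g 0ℝ x I × IsIntegral h 0ℝ x J ×
    (I + fromNat n * ƛ * J ≈ (1ℝ + x) * F n x))
theorem13 ƛ _ n S isS F isF x =
  unwrap (≃-trans ([1+x]*degFubini ƛ F isF n x)
    (+-cong-≃ (logFubini-degStirling₂ ƛ S isS (suc n) x) (*-congˡ-≃ (logFubini-degStirling₂ ƛ S isS n x)))) ,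
  λ g h g-quot h-quot →
    logFubini ƛ (suc n) x , logFubini ƛ n x ,
    ∫degFubini/t ƛ F g isF (suc n) g-quot x , ∫degFubini/t ƛ F h isF n h-quot x ,
    unwrap (≃-sym ([1+x]*degFubini ƛ F isF n x))
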